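{- Let $N$ and $v$ be integers with $3\le v<N$. Then $\mathcal L(N,v)$ is an admissible $v$-type.
   Context: Let $f=\lfloor\frac{N+1}{v}\rfloor$, $d=(f+1)v-N$; binomial coefficients with negative lower index are $0$ and empty sums are $0$. A $v$-shape is a multiset of $v$ nonnegative integers; $\mu_M(x)$ is the number of entries of the shape $M$ equal to $x$. A multiset $\mathcal M$ of $v$-shapes (a $v$-type) is admissible if $\sum_{M\in\mathcal M}\mu_M(x)\le\binom{N}{x}$ for $0\le x\le N$. For $0\le i\le f$, $L_i(N,v)$ is the $v$-shape consisting of the entry $i$ together with $v-1$ further entries summing to $N-i$ and pairwise differing by at most $1$. If $N\equiv v-1\pmod v$, $L_*(N,v)$ is the $v$-shape with two entries $f-1$, $v-3$ entries $f$ and one entry $f+1$. Let $s=\sum_{i=f-d+2}^{f-1}(d-f-1+i)\binom{N}{i}$ and $s'=\sum_{i=f-v+1}^{f-2}(v-f+i)\binom{N}{i}$. $\mathcal L(N,v)$ consists of: $\binom{N}{i}$ copies of $L_i(N,v)$ for $0\le i\le f-2$; if $N\not\equiv v-1\pmod v$, additionally $\binom{N}{f-1}$ copies of $L_{f-1}(N,v)$ and $\lfloor\frac1d(\binom{N}{f}-s)\rfloor$ copies of $L_f(N,v)$; if $N\equiv v-1\pmod v$, additionally $\binom{N}{f-1}-2\lceil\frac{s'}{v+1}\rceil$ copies of $L_{f-1}(N,v)$ and $\lceil\frac{s'}{v+1}\rceil$ copies of $L_*(N,v)$. -}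

module Defs where

open import Data.Nat as ℕ using (ℕ; zero; suc; _∸_; _/_; _%_)
open import Data.Nat.Combinatorics using (_C_)
open import Data.Nat.Divisibility using (_∣?_)
open import Data.Integer as ℤ using (ℤ; +_; -[1+_]; 0ℤ; _-_; -_)
open import Data.List using (List; []; _∷_; _++_; replicate; map; upTo; foldr)
open import Data.Product using (_×_; _,_)
open import Relation.Nullary using (yes; no)
open import Relation.Binary.PropositionalEquality using (_≡_)

-- natural-number division/remainder with junk value at divisor 0
-- (never used at 0 below)
divN : ℕ → ℕ → ℕ
divN n zero = 0
divN n (suc k) = n / suc k

modN : ℕ → ℕ → ℕ
modN n zero = 0
modN n (suc k) = n % suc k

-- floor(x / m) for an integer x and a positive natural m (junk 0 for m = 0)
floorDiv : ℤ → ℕ → ℤ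
floorDiv x zero = 0ℤ
floorDiv (+ n) (suc k) = + (n / suc k)
floorDiv -[1+ n ] (suc k) = -[1+ (n / suc k) ]

ceilDiv : ℤ → ℕ → ℤ
ceilDiv x m = - floorDiv (- x) m

binomZ : ℕ → ℤ → ℤ
binomZ N (+ k) = + (N C k)
binomZ N -[1+ _ ] = 0ℤ

sumℤ : List ℤ → ℤ
sumℤ = foldr ℤ._+_ 0ℤ

clamp : ℤ → ℕ
clamp (+ n) = n
clamp -[1+ _ ] = 0

-- Σ_{i=a}^{b} g i  (empty sum = 0 when b < a)
rangeSum : ℤ → ℤ → (ℤ → ℤ) → ℤ
rangeSum a b g = sumℤ (map (λ j → g (a ℤ.+ + j)) (upTo (clamp ((b ℤ.+ + 1) - a))))

fOf : ℕ → ℕ → ℕ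
fOf N v = divN (suc N) v

dOf : ℕ → ℕ → ℤ
dOf N v = (+ (suc (fOf N v) ℕ.* v)) - + N

-- a v-shape is represented as a list of naturals (of length v);
-- μ M x = number of entries of M equal to x
μ : List ℕ → ℕ → ℕ
μ [] x = 0
μ (y ∷ M) x with y ℕ.≟ x
... | yes _ = suc (μ M x)
... | no _ = μ M x

-- a v-type is represented as a list of (multiplicity, shape) pairs
VType : Set
VType = List (ℤ × List ℕ)

total : VType → ℕ → ℤ
total 𝓜 x = sumℤ (map (λ { (m , M) → m ℤ.* + (μ M x) }) 𝓜)

-- L_i(N,v): entry i plus v−1 entries summing to N−i, pairwise differing by ≤ 1
Lshape : ℕ → ℕ → ℕ → List ℕ
Lshape N v i = i ∷ (replicate r (suc q) ++ replicate ((v ∸ 1) ∸ r) q)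
  where
  q = divN (N ∸ i) (v ∸ 1)
  r = modN (N ∸ i) (v ∸ 1)

Lstar : ℕ → ℕ → List ℕ
Lstar N v = replicate 2 (f ∸ 1) ++ (replicate (v ∸ 3) f ++ (suc f ∷ []))
  where f = fOf N v

sOf : ℕ → ℕ → ℤ
sOf N v = rangeSum (f - d ℤ.+ + 2) (f - + 1) (λ i → (d - f - + 1 ℤ.+ i) ℤ.* binomZ N i)
  where
  f = + fOf N v
  d = dOf N v

s'Of : ℕ → ℕ → ℤ
s'Of N v = rangeSum (f - + v ℤ.+ + 1) (f - + 2) (λ i → (+ v - f ℤ.+ i) ℤ.* binomZ N i)
  where f = + fOf N v

𝓛 : ℕ → ℕ → VType
𝓛 N v = map (λ i → (+ (N C i) , Lshape N v i)) (upTo (f ∸ 1)) ++ rest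
  where
  f = fOf N v
  rest : VType
  rest with v ∣? suc N   -- N ≡ v − 1 (mod v)  ⇔  v ∣ N + 1
  ... | no _ = (+ (N C (f ∸ 1)) , Lshape N v (f ∸ 1))
             ∷ (floorDiv (+ (N C f) - sOf N v) (clamp (dOf N v)) , Lshape N v f)
             ∷ []
  ... | yes _ = (+ (N C (f ∸ 1)) - (+ 2) ℤ.* ceilDiv (s'Of N v) (suc v) , Lshape N v (f ∸ 1))
              ∷ (ceilDiv (s'Of N v) (suc v) , Lstar N v)
              ∷ []

-- Write v = m + 1.  Apart from its first entry i, the shape L_i is the balanced
-- partition of N - i into m parts, so it contains at most m entries equal to x, and
-- none unless (x - 1) m < N - i < (x + 1) m.  Summing over 𝓛:
--   * below f only the entries i = x count, and the total is exactly C(N, x);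
--   * at x = f (and x = f - 1 when v ∣ N + 1) the shortfall is exactly what s, s′ and
--     the multiplicities of L_f, L_{f-1}, L_* were chosen to fill;
--   * above f + 1 only i ≤ f - 2 contribute, at most m C(N, i) each, and
--     m Σ_{i ≤ f-2} C(N, i) ≤ C(N, f) ≤ C(N, x) by geometric growth and unimodality.
-- The value x = f + 1 is the delicate one.  Below f the binomial coefficients grow at
-- least by the ratio (N - f + 1)/f, so the weighted sums of C(N, i) are bounded by
-- geometric series in C(N, f); comparing with C(N, f + 1) = (N - f) C(N, f)/(f + 1)
-- leaves a polynomial inequality, proved by exhibiting the difference as a polynomial
-- with nonnegative coefficients.

module Submission where

open import Data.Nat.Base
open import Data.Nat.Base as ℕ using ()
open import Data.Nat.Properties
import Data.Nat.Properties as ℕ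
open import Data.Nat.DivMod using (m%n<n; m≡m%n+[m/n]*n; m/n*n≤m; m<n⇒m/n≡0; m*n/n≡m; +-distrib-/-∣ʳ)
open import Data.Nat.Divisibility using (_∣_; _∣?_; n∣m*n; ∣m+n∣m⇒∣n; ∣⇒≤)
open import Data.Nat.Combinatorics using (_C_; nCk+nC[k+1]≡[n+1]C[k+1]; nC1≡n; k>n⇒nCk≡0; nCk≡nC[n∸k])
open import Data.List.Base using (List; []; _∷_; _++_; _∷ʳ_; replicate; map; upTo; length)
open import Data.List.Properties using (length-++; length-replicate; upTo-∷ʳ; map-++; map-cong)
open import Data.List.Relation.Unary.All using (All; []; _∷_)
open import Data.List.Relation.Unary.All.Properties using (++⁺; map⁺; applyUpTo⁺₂)
open import Data.Product using (_×_; _,_; proj₁; proj₂)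
open import Data.Sum using (_⊎_; inj₁; inj₂)
open import Data.Empty using (⊥-elim)
open import Relation.Nullary using (yes; no; ¬_)
open import Relation.Binary.PropositionalEquality
open import Relation.Binary.Definitions using (tri<; tri≈; tri>)
open import Function.Base using (_$_; _∘_; _∘′_)
open import Data.Nat.Tactic.RingSolver using (solve-∀)
import Algebra.Properties.CommutativeSemigroup as CommutativeSemigroupProperties

open import Defs

module +-CS = CommutativeSemigroupProperties +-commutativeSemigroup
module *-CS = CommutativeSemigroupProperties *-commutativeSemigroup

cong₃ : ∀ {A B C D : Set} (f : A → B → C → D) {a a′ b b′ c c′} → a ≡ a′ → b ≡ b′ → c ≡ c′ → f a b c ≡ f a′ b′ c′
cong₃ f refl refl refl = refl

∑< : ℕ → (ℕ → ℕ) → ℕ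
∑< zero    g = 0
∑< (suc n) g = ∑< n g + g n

syntax ∑< n (λ i → e) = ∑[ i < n ] e

module _ {g h : ℕ → ℕ} where

  ∑-cong : ∀ n → (∀ {i} → i < n → g i ≡ h i) → ∑< n g ≡ ∑< n h
  ∑-cong zero    eq = refl
  ∑-cong (suc n) eq = cong₂ _+_ (∑-cong n (λ i<n → eq (m<n⇒m<1+n i<n))) (eq ≤-refl)

  ∑-mono-≤ : ∀ n → (∀ {i} → i < n → g i ≤ h i) → ∑< n g ≤ ∑< n h
  ∑-mono-≤ zero    le = z≤n
  ∑-mono-≤ (suc n) le = +-mono-≤ (∑-mono-≤ n (λ i<n → le (m<n⇒m<1+n i<n))) (le ≤-refl)

  ∑-distrib-+ : ∀ n → ∑[ i < n ] (g i + h i) ≡ ∑< n g + ∑< n h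
  ∑-distrib-+ zero    = refl
  ∑-distrib-+ (suc n) = begin
    ∑[ i < n ] (g i + h i) + (g n + h n)  ≡⟨ cong (_+ (g n + h n)) (∑-distrib-+ n) ⟩
    ∑< n g + ∑< n h + (g n + h n)         ≡⟨ +-CS.interchange (∑< n g) (∑< n h) (g n) (h n) ⟩
    ∑< n g + g n + (∑< n h + h n)         ∎
    where open ≡-Reasoning

∑-zero : ∀ {g : ℕ → ℕ} n → (∀ {i} → i < n → g i ≡ 0) → ∑< n g ≡ 0
∑-zero zero    eq = refl
∑-zero (suc n) eq = cong₂ _+_ (∑-zero n (λ i<n → eq (m<n⇒m<1+n i<n))) (eq ≤-refl)

*-distribˡ-∑ : ∀ k (g : ℕ → ℕ) n → k * ∑< n g ≡ ∑[ i < n ] (k * g i)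
*-distribˡ-∑ k g zero    = *-zeroʳ k
*-distribˡ-∑ k g (suc n) = trans (*-distribˡ-+ k (∑< n g) (g n)) (cong (_+ k * g n) (*-distribˡ-∑ k g n))

δ : ℕ → ℕ → ℕ
δ i x with i ≟ x
... | yes _ = 1
... | no  _ = 0

δ-refl : ∀ x → δ x x ≡ 1
δ-refl x with x ≟ x
... | yes _   = refl
... | no  x≢x = ⊥-elim (x≢x refl)

δ-≢ : ∀ {i x} → i ≢ x → δ i x ≡ 0
δ-≢ {i} {x} i≢x with i ≟ x
... | yes i≡x = ⊥-elim (i≢x i≡x)
... | no  _   = refl

∑-δ-< : ∀ (g : ℕ → ℕ) {x} n → x < n → ∑[ i < n ] (g i * δ i x) ≡ g x
∑-δ-< g {x} (suc n) x<1+n with x ≟ n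
... | yes refl = begin
  ∑[ i < x ] (g i * δ i x) + g x * δ x x  ≡⟨ cong₂ _+_ (∑-zero {λ i → g i * δ i x} x (λ i<x → *-δ-≢ (<⇒≢ i<x)))
                                                       (cong (g x *_) (δ-refl x)) ⟩
  0 + g x * 1                            ≡⟨ *-identityʳ (g x) ⟩
  g x                                    ∎
  where
  open ≡-Reasoning
  *-δ-≢ : ∀ {i} → i ≢ x → g i * δ i x ≡ 0
  *-δ-≢ {i} i≢x = trans (cong (g i *_) (δ-≢ i≢x)) (*-zeroʳ (g i))
... | no x≢n = begin
  ∑[ i < n ] (g i * δ i x) + g n * δ n x  ≡⟨ cong₂ _+_ (∑-δ-< g n (≤∧≢⇒< (≤-pred x<1+n) x≢n)) (cong (g n *_) (δ-≢ (x≢n ∘ sym))) ⟩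
  g x + g n * 0                          ≡⟨ cong (g x +_) (*-zeroʳ (g n)) ⟩
  g x + 0                                ≡⟨ +-identityʳ (g x) ⟩
  g x                                    ∎
  where open ≡-Reasoning

∑-δ-≥ : ∀ (g : ℕ → ℕ) {x} n → n ≤ x → ∑[ i < n ] (g i * δ i x) ≡ 0
∑-δ-≥ g {x} n n≤x = ∑-zero {λ i → g i * δ i x} n λ {i} i<n →
  trans (cong (g i *_) (δ-≢ (<⇒≢ (<-≤-trans i<n n≤x)))) (*-zeroʳ (g i))

μ-∷ : ∀ y M x → μ (y ∷ M) x ≡ δ y x + μ M x
μ-∷ y M x with y ≟ x
... | yes _ = refl
... | no  _ = refl

μ-++ : ∀ A B x → μ (A ++ B) x ≡ μ A x + μ B x
μ-++ []      B x = refl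
μ-++ (y ∷ A) B x = begin
  μ (y ∷ A ++ B) x          ≡⟨ μ-∷ y (A ++ B) x ⟩
  δ y x + μ (A ++ B) x      ≡⟨ cong (δ y x +_) (μ-++ A B x) ⟩
  δ y x + (μ A x + μ B x)   ≡⟨ +-assoc (δ y x) (μ A x) (μ B x) ⟨
  δ y x + μ A x + μ B x     ≡⟨ cong (_+ μ B x) (μ-∷ y A x) ⟨
  μ (y ∷ A) x + μ B x       ∎
  where open ≡-Reasoning

μ-replicate : ∀ n y x → μ (replicate n y) x ≡ n * δ y x
μ-replicate zero    y x = refl
μ-replicate (suc n) y x = trans (μ-∷ y (replicate n y) x) (cong (δ y x +_) (μ-replicate n y x))

-- Balanced partitions

balanced : (m : ℕ) .{{_ : NonZero m}} → ℕ → List ℕ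
balanced m n = replicate (n % m) (suc (n / m)) ++ replicate (m ∸ n % m) (n / m)

module BalancedCount (m : ℕ) .{{_ : NonZero m}} where

  private
    count : ℕ → ℕ → ℕ → ℕ
    count q r x = r * δ (suc q) x + (m ∸ r) * δ q x

    μ-balanced : ∀ n x → μ (balanced m n) x ≡ count (n / m) (n % m) x
    μ-balanced n x = trans (μ-++ (replicate r (suc q)) _ x)
                           (cong₂ _+_ (μ-replicate r (suc q) x) (μ-replicate (m ∸ r) q x))
      where q = n / m ; r = n % m

    count-suc : ∀ q r → count q r (suc q) ≡ r
    count-suc q r = begin
      r * δ (suc q) (suc q) + (m ∸ r) * δ q (suc q) ≡⟨ cong₂ (λ a b → r * a + (m ∸ r) * b) (δ-refl (suc q)) (δ-≢ (<⇒≢ (n<1+n q))) ⟩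
      r * 1 + (m ∸ r) * 0                           ≡⟨ cong₂ _+_ (*-identityʳ r) (*-zeroʳ (m ∸ r)) ⟩
      r + 0                                         ≡⟨ +-identityʳ r ⟩
      r                                             ∎
      where open ≡-Reasoning

    count-self : ∀ q r → count q r q ≡ m ∸ r
    count-self q r = begin
      r * δ (suc q) q + (m ∸ r) * δ q q ≡⟨ cong₂ (λ a b → r * a + (m ∸ r) * b) (δ-≢ (1+n≢n {q})) (δ-refl q) ⟩
      r * 0 + (m ∸ r) * 1               ≡⟨ cong₂ _+_ (*-zeroʳ r) (*-identityʳ (m ∸ r)) ⟩
      m ∸ r                             ∎
      where open ≡-Reasoning

    count-other : ∀ q r {x} → x ≢ suc q → x ≢ q → count q r x ≡ 0
    count-other q r {x} x≢1+q x≢q = trans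
      (cong₂ (λ a b → r * a + (m ∸ r) * b) (δ-≢ (x≢1+q ∘ sym)) (δ-≢ (x≢q ∘ sym)))
      (cong₂ _+_ (*-zeroʳ r) (*-zeroʳ (m ∸ r)))

    count-≤ : ∀ q r x → r ≤ m → count q r x ≤ m
    count-≤ q r x r≤m with x ≟ suc q | x ≟ q
    ... | yes refl | _        = ≤-trans (≤-reflexive (count-suc q r)) r≤m
    ... | no _     | yes refl = ≤-trans (≤-reflexive (count-self q r)) (m∸n≤m m r)
    ... | no x≢1+q | no x≢q   = ≤-trans (≤-reflexive (count-other q r x≢1+q x≢q)) z≤n

    count-≤-below : ∀ q r x e → r ≤ m → suc x * m ≤ (r + q * m) + e → count q r x ≤ e
    count-≤-below q r x e r≤m le with x ≟ suc q | x ≟ q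
    ... | yes refl | _        = ≤-trans (≤-reflexive (count-suc q r)) (+-cancelˡ-≤ (r + q * m) r e (begin
          (r + q * m) + r   ≡⟨ +-comm (r + q * m) r ⟩
          r + (r + q * m)   ≤⟨ +-mono-≤ r≤m (+-monoˡ-≤ (q * m) r≤m) ⟩
          m + (m + q * m)   ≤⟨ le ⟩
          (r + q * m) + e   ∎))
      where open ≤-Reasoning
    ... | no _     | yes refl = ≤-trans (≤-reflexive (count-self q r)) (m≤n+o⇒m∸n≤o m r (+-cancelʳ-≤ (q * m) m (r + e) (begin
          m + q * m         ≤⟨ le ⟩
          (r + q * m) + e   ≡⟨ +-CS.xy∙z≈xz∙y r (q * m) e ⟩
          (r + e) + q * m   ∎)))
      where open ≤-Reasoning
    ... | no x≢1+q | no x≢q   = ≤-trans (≤-reflexive (count-other q r x≢1+q x≢q)) z≤n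

    count-≤-above : ∀ q r x e → r ≤ m → (r + q * m) + m ≤ x * m + e → count q r x ≤ e
    count-≤-above q r x e r≤m le with x ≟ suc q | x ≟ q
    ... | yes refl | _        = ≤-trans (≤-reflexive (count-suc q r)) (+-cancelˡ-≤ (m + q * m) r e (begin
          (m + q * m) + r   ≡⟨ +-CS.xy∙z≈zy∙x m (q * m) r ⟩
          (r + q * m) + m   ≤⟨ le ⟩
          (m + q * m) + e   ∎))
      where open ≤-Reasoning
    ... | no _     | yes refl = ≤-trans (≤-reflexive (count-self q r)) (≤-trans (m∸n≤m m r) (+-cancelˡ-≤ (q * m) m e (begin
          q * m + m         ≤⟨ +-monoˡ-≤ m (m≤n+m (q * m) r) ⟩
          (r + q * m) + m   ≤⟨ le ⟩
          q * m + e         ∎)))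
      where open ≤-Reasoning
    ... | no x≢1+q | no x≢q   = ≤-trans (≤-reflexive (count-other q r x≢1+q x≢q)) z≤n

  private
    n≡r+qm : ∀ n → n ≡ n % m + (n / m) * m
    n≡r+qm n = m≡m%n+[m/n]*n n m

    r≤m : ∀ n → n % m ≤ m
    r≤m n = <⇒≤ (m%n<n n m)

  μ-balanced-≤ : ∀ n x → μ (balanced m n) x ≤ m
  μ-balanced-≤ n x = ≤-trans (≤-reflexive (μ-balanced n x)) (count-≤ (n / m) (n % m) x (r≤m n))

  μ-balanced-≤-below : ∀ n x e → suc x * m ≤ n + e → μ (balanced m n) x ≤ e
  μ-balanced-≤-below n x e le = ≤-trans (≤-reflexive (μ-balanced n x))
    (count-≤-below (n / m) (n % m) x e (r≤m n) (subst (λ k → suc x * m ≤ k + e) (n≡r+qm n) le))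

  μ-balanced-≤-above : ∀ n x e → n + m ≤ x * m + e → μ (balanced m n) x ≤ e
  μ-balanced-≤-above n x e le = ≤-trans (≤-reflexive (μ-balanced n x))
    (count-≤-above (n / m) (n % m) x e (r≤m n) (subst (λ k → k + m ≤ x * m + e) (n≡r+qm n) le))

-- Ratio bounds and geometric growth

infix 4 _≤[_÷_]_

-- a ≤ (p / q) · b, kept as a record so that p and q can be inferred
record _≤[_÷_]_ (a p q b : ℕ) : Set where
  constructor ratio
  field cross : q * a ≤ p * b

open _≤[_÷_]_

≤[÷]-compose : ∀ {a b c p q p′ q′} → a ≤[ p ÷ q ] b → b ≤[ p′ ÷ q′ ] c → a ≤[ p * p′ ÷ q * q′ ] c
≤[÷]-compose {a} {b} {c} {p} {q} {p′} {q′} (ratio ab) (ratio bc) = ratio $ begin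
  q * q′ * a     ≡⟨ *-CS.xy∙z≈y∙xz q q′ a ⟩
  q′ * (q * a)   ≤⟨ *-monoʳ-≤ q′ ab ⟩
  q′ * (p * b)   ≡⟨ *-CS.x∙yz≈y∙xz q′ p b ⟩
  p * (q′ * b)   ≤⟨ *-monoʳ-≤ p bc ⟩
  p * (p′ * c)   ≡⟨ *-assoc p p′ c ⟨
  p * p′ * c     ∎
  where open ≤-Reasoning

≤[÷]-+ : ∀ {a b c p p′ q} → a ≤[ p ÷ q ] c → b ≤[ p′ ÷ q ] c → a + b ≤[ p + p′ ÷ q ] c
≤[÷]-+ {a} {b} {c} {p} {p′} {q} (ratio ac) (ratio bc) = ratio $ begin
  q * (a + b)        ≡⟨ *-distribˡ-+ q a b ⟩
  q * a + q * b      ≤⟨ +-mono-≤ ac bc ⟩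
  p * c + p′ * c     ≡⟨ *-distribʳ-+ c p p′ ⟨
  (p + p′) * c       ∎
  where open ≤-Reasoning

≤[÷]-+′ : ∀ {a b c p q p′ q′} → a ≤[ p ÷ q ] c → b ≤[ p′ ÷ q′ ] c → a + b ≤[ q′ * p + q * p′ ÷ q * q′ ] c
≤[÷]-+′ {a} {b} {c} {p} {q} {p′} {q′} (ratio ac) (ratio bc) = ratio $ begin
  q * q′ * (a + b)               ≡⟨ spread q q′ a b ⟩
  q′ * (q * a) + q * (q′ * b)    ≤⟨ +-mono-≤ (*-monoʳ-≤ q′ ac) (*-monoʳ-≤ q bc) ⟩
  q′ * (p * c) + q * (p′ * c)    ≡⟨ collect q′ p q p′ c ⟩
  (q′ * p + q * p′) * c          ∎
  where
  open ≤-Reasoning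
  spread : ∀ q q′ a b → q * q′ * (a + b) ≡ q′ * (q * a) + q * (q′ * b)
  spread = solve-∀
  collect : ∀ q′ p q p′ c → q′ * (p * c) + q * (p′ * c) ≡ (q′ * p + q * p′) * c
  collect = solve-∀

≤[÷]-congˡ : ∀ {a a′ b p q} → a ≡ a′ → a ≤[ p ÷ q ] b → a′ ≤[ p ÷ q ] b
≤[÷]-congˡ refl ab = ab

≤[÷]-refl : ∀ q a → a ≤[ q ÷ q ] a
≤[÷]-refl q a = ratio ≤-refl

≤[÷]-scale : ∀ k {a b p q} → a ≤[ p ÷ q ] b → k * a ≤[ k * p ÷ q ] b
≤[÷]-scale k {a} {b} {p} {q} (ratio ab) = ratio $ begin
  q * (k * a)   ≡⟨ *-CS.x∙yz≈y∙xz q k a ⟩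
  k * (q * a)   ≤⟨ *-monoʳ-≤ k ab ⟩
  k * (p * b)   ≡⟨ *-assoc k p b ⟨
  k * p * b     ∎
  where open ≤-Reasoning

≤[÷]-expand : ∀ k {a b p q} → a ≤[ p ÷ q ] b → a ≤[ k * p ÷ k * q ] b
≤[÷]-expand k {a} {b} {p} {q} (ratio ab) = ratio $ begin
  k * q * a     ≡⟨ *-assoc k q a ⟩
  k * (q * a)   ≤⟨ *-monoʳ-≤ k ab ⟩
  k * (p * b)   ≡⟨ *-assoc k p b ⟨
  k * p * b     ∎
  where open ≤-Reasoning

≤[÷]⇒≤ : ∀ {a b p q} .{{_ : NonZero q}} → p ≤ q → a ≤[ p ÷ q ] b → a ≤ b
≤[÷]⇒≤ {a} {b} {p} {q} p≤q (ratio ab) = *-cancelˡ-≤ q (≤-trans ab (*-monoˡ-≤ b p≤q))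

record Geometric (c : ℕ → ℕ) (α γ a : ℕ) : Set where
  constructor growth
  field grows : ∀ {j} → j < a → c j ≤[ α ÷ γ + α ] c (suc j)

open Geometric

module _ {c : ℕ → ℕ} {α γ : ℕ} where

  geometric-≤ : ∀ {a b} → b ≤ a → Geometric c α γ a → Geometric c α γ b
  geometric-≤ b≤a geo = growth λ j<b → grows geo (<-≤-trans j<b b≤a)

  ∑-geometric : ∀ {a} → Geometric c α γ a → ∑< a c ≤[ α ÷ γ ] c a
  ∑-geometric {zero}  geo = ratio $ ≤-trans (≤-reflexive (*-zeroʳ γ)) z≤n
  ∑-geometric {suc a} geo = ratio $ begin
    γ * (∑< a c + c a)        ≡⟨ *-distribˡ-+ γ (∑< a c) (c a) ⟩
    γ * ∑< a c + γ * c a      ≤⟨ +-monoˡ-≤ (γ * c a) (cross (∑-geometric (geometric-≤ (n≤1+n a) geo))) ⟩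
    α * c a + γ * c a         ≡⟨ trans (+-comm (α * c a) (γ * c a)) (sym (*-distribʳ-+ (c a) γ α)) ⟩
    (γ + α) * c a             ≤⟨ cross (grows geo ≤-refl) ⟩
    α * c (suc a)             ∎
    where open ≤-Reasoning

∑-geometric-tail : ∀ {c α γ a} m′ .{{_ : NonZero γ}} → α * m′ ≤ γ → α ≤ γ → Geometric c α γ (suc a) →
                   suc m′ * ∑< a c ≤ c (suc a)
∑-geometric-tail {c} {α} {γ} {a} m′ αm′≤γ α≤γ geo =
  ≤[÷]⇒≤ {{m*n≢0 γ (γ + α)}} key
    (≤[÷]-scale (suc m′) (≤[÷]-compose (∑-geometric (geometric-≤ (n≤1+n a) geo)) (grows geo ≤-refl)))
  where
  open ≤-Reasoning
  instance
    γ+α≢0 : NonZero (γ + α)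
    γ+α≢0 = >-nonZero (<-≤-trans (>-nonZero⁻¹ γ) (m≤m+n γ α))
  key : suc m′ * (α * α) ≤ γ * (γ + α)
  key = begin
    suc m′ * (α * α)       ≡⟨ regroup m′ α ⟩
    (α * m′ + α) * α       ≤⟨ *-mono-≤ (+-monoˡ-≤ α αm′≤γ) α≤γ ⟩
    (γ + α) * γ            ≡⟨ *-comm (γ + α) γ ⟩
    γ * (γ + α)            ∎
    where
    regroup : ∀ m′ α → suc m′ * (α * α) ≡ (α * m′ + α) * α
    regroup = solve-∀

weighted : (ℕ → ℕ) → ℕ → (ℕ → ℕ) → ℕ
weighted c a w = ∑[ i < a ] (c i * w (a ∸ i))

weighted-cong : ∀ c a {w w′ : ℕ → ℕ} → (∀ j → w j ≡ w′ j) → weighted c a w ≡ weighted c a w′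
weighted-cong c a eq = ∑-cong a (λ {i} _ → cong (c i *_) (eq (a ∸ i)))

weighted-suc : ∀ c a w → weighted c (suc a) w ≡ weighted c a (λ j → w (suc j)) + c a * w 1
weighted-suc c a w = cong₂ _+_
  (∑-cong a (λ {i} i<a → cong (λ k → c i * w k) (+-∸-assoc 1 (<⇒≤ i<a))))
  (cong (λ k → c a * w k) (m+n∸n≡m 1 a))

ramp : (ℕ → ℕ) → ℕ → ℕ → ℕ
ramp c a D = weighted c a (λ j → suc D ∸ j)

ramp-suc : ∀ c a D → ramp c (suc a) (suc D) ≡ ramp c a D + c a * suc D
ramp-suc c a D = weighted-suc c a (λ j → suc (suc D) ∸ j)

ramp-zero : ∀ c a → ramp c a 0 ≡ 0
ramp-zero c a = ∑-zero a λ {i} i<a →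
  trans (cong (c i *_) (m≤n⇒m∸n≡0 (m<n⇒0<n∸m i<a))) (*-zeroʳ (c i))

linear : (ℕ → ℕ) → ℕ → ℕ → ℕ
linear c a e = weighted c a (e +_)

linear-suc : ∀ c a e → linear c (suc a) e ≡ linear c a (suc e) + c a * suc e
linear-suc c a e = trans (weighted-suc c a (e +_))
  (cong₂ _+_ (weighted-cong c a (+-suc e)) (cong (c a *_) (+-comm e 1)))

module _ {c : ℕ → ℕ} {α γ : ℕ} where

  ramp-geometric : ∀ {a} D → Geometric c α γ a → ramp c a D ≤[ D * α ÷ γ ] c a
  ramp-geometric {zero}  D       geo = ratio $ ≤-trans (≤-reflexive (*-zeroʳ γ)) z≤n
  ramp-geometric {suc a} zero    geo = ratio $ ≤-trans (≤-reflexive (trans (cong (γ *_) (ramp-zero c (suc a))) (*-zeroʳ γ))) z≤n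
  ramp-geometric {suc a} (suc D) geo = ratio $ begin
    γ * ramp c (suc a) (suc D)                      ≡⟨ cong (γ *_) (ramp-suc c a D) ⟩
    γ * (ramp c a D + c a * suc D)                  ≡⟨ *-distribˡ-+ γ (ramp c a D) (c a * suc D) ⟩
    γ * ramp c a D + γ * (c a * suc D)              ≤⟨ +-monoˡ-≤ _ (cross (ramp-geometric D (geometric-≤ (n≤1+n a) geo))) ⟩
    D * α * c a + γ * (c a * suc D)                 ≤⟨ m≤m+n _ (α * c a) ⟩
    D * α * c a + γ * (c a * suc D) + α * c a       ≡⟨ regroup α γ D (c a) ⟩
    suc D * ((γ + α) * c a)                         ≤⟨ *-monoʳ-≤ (suc D) (cross (grows geo ≤-refl)) ⟩
    suc D * (α * c (suc a))                         ≡⟨ *-assoc (suc D) α (c (suc a)) ⟨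
    suc D * α * c (suc a)                           ∎
    where
    open ≤-Reasoning
    regroup : ∀ α γ D x → D * α * x + γ * (x * suc D) + α * x ≡ suc D * ((γ + α) * x)
    regroup = solve-∀

  linear-geometric : α ≤ γ → ∀ {a} e → Geometric c α γ a → linear c a e ≤[ (2 + e) * α ÷ γ ] c a
  linear-geometric α≤γ {zero}  e geo = ratio $ ≤-trans (≤-reflexive (*-zeroʳ γ)) z≤n
  linear-geometric α≤γ {suc a} e geo = ratio $ begin
    γ * linear c (suc a) e                               ≡⟨ cong (γ *_) (linear-suc c a e) ⟩
    γ * (linear c a (suc e) + c a * suc e)               ≡⟨ *-distribˡ-+ γ (linear c a (suc e)) (c a * suc e) ⟩
    γ * linear c a (suc e) + γ * (c a * suc e)           ≤⟨ +-monoˡ-≤ _ (cross (linear-geometric α≤γ (suc e) (geometric-≤ (n≤1+n a) geo))) ⟩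
    (3 + e) * α * c a + γ * (c a * suc e)                ≡⟨ split α γ e (c a) ⟩
    (2 + e) * α * c a + γ * (c a * suc e) + α * c a      ≤⟨ +-monoʳ-≤ _ (*-monoˡ-≤ (c a) α≤γ) ⟩
    (2 + e) * α * c a + γ * (c a * suc e) + γ * c a      ≡⟨ regroup α γ e (c a) ⟩
    (2 + e) * ((γ + α) * c a)                            ≤⟨ *-monoʳ-≤ (2 + e) (cross (grows geo ≤-refl)) ⟩
    (2 + e) * (α * c (suc a))                            ≡⟨ *-assoc (2 + e) α (c (suc a)) ⟨
    (2 + e) * α * c (suc a)                              ∎
    where
    open ≤-Reasoning
    split : ∀ α γ e x → (3 + e) * α * x + γ * (x * suc e) ≡ (2 + e) * α * x + γ * (x * suc e) + α * x
    split = solve-∀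
    regroup : ∀ α γ e x → (2 + e) * α * x + γ * (x * suc e) + γ * x ≡ (2 + e) * ((γ + α) * x)
    regroup = solve-∀

  ramp₂-geometric : ∀ {a} → Geometric c α γ a →
    ramp c a 2 ≤[ α * α + (γ + α) * (2 * α) ÷ (γ + α) * (γ + α) ] c a
  ramp₂-geometric {zero}        geo = ratio $ ≤-trans (≤-reflexive (*-zeroʳ ((γ + α) * (γ + α)))) z≤n
  ramp₂-geometric {suc zero}    geo = ratio $ ≤-trans (cross (≤[÷]-expand (γ + α) twice-c₀)) (*-monoˡ-≤ (c 1) (m≤n+m _ (α * α)))
    where
    twice-c₀ : ramp c 1 2 ≤[ 2 * α ÷ γ + α ] c 1
    twice-c₀ = subst (_≤[ 2 * α ÷ γ + α ] c 1) (*-comm 2 (c 0)) (≤[÷]-scale 2 (grows geo ≤-refl))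
  ramp₂-geometric {suc (suc a)} geo =
    subst (_≤[ α * α + (γ + α) * (2 * α) ÷ (γ + α) * (γ + α) ] c (2 + a)) (sym unfold)
      (≤[÷]-+ (≤[÷]-compose (grows geo (m<n⇒m<1+n (n<1+n a))) (grows geo ≤-refl))
              (≤[÷]-expand (γ + α) (≤[÷]-scale 2 (grows geo ≤-refl))))
    where
    unfold : ramp c (2 + a) 2 ≡ c a + 2 * c (suc a)
    unfold = begin
      ramp c (2 + a) 2                         ≡⟨ ramp-suc c (suc a) 1 ⟩
      ramp c (suc a) 1 + c (suc a) * 2         ≡⟨ cong (_+ c (suc a) * 2) (ramp-suc c a 0) ⟩
      ramp c a 0 + c a * 1 + c (suc a) * 2     ≡⟨ cong (λ z → z + c a * 1 + c (suc a) * 2) (ramp-zero c a) ⟩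
      c a * 1 + c (suc a) * 2                  ≡⟨ cong₂ _+_ (*-identityʳ (c a)) (*-comm (c (suc a)) 2) ⟩
      c a + 2 * c (suc a)                      ∎
      where open ≡-Reasoning

-- Binomial coefficients

[1+k]*[1+n]C[1+k]≡[1+n]*nCk : ∀ n k → suc k * (suc n C suc k) ≡ suc n * (n C k)
[1+k]*[1+n]C[1+k]≡[1+n]*nCk zero    zero    = refl
[1+k]*[1+n]C[1+k]≡[1+n]*nCk zero    (suc k) rewrite k>n⇒nCk≡0 {1} {2 + k} (s≤s (s≤s z≤n)) = *-zeroʳ (2 + k)
[1+k]*[1+n]C[1+k]≡[1+n]*nCk (suc n) zero    = trans (*-identityˡ _) (trans (nC1≡n (2 + n)) (sym (*-identityʳ _)))
[1+k]*[1+n]C[1+k]≡[1+n]*nCk (suc n) (suc k) = begin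
  (2 + k) * ((2 + n) C (2 + k))                     ≡⟨ cong ((2 + k) *_) (nCk+nC[k+1]≡[n+1]C[k+1] (suc n) (suc k)) ⟨
  (2 + k) * (A + B)                             ≡⟨ *-distribˡ-+ (2 + k) A B ⟩
  A + (1 + k) * A + (2 + k) * B                 ≡⟨ cong₂ (λ x y → A + x + y) ([1+k]*[1+n]C[1+k]≡[1+n]*nCk n k)
                                                                            ([1+k]*[1+n]C[1+k]≡[1+n]*nCk n (suc k)) ⟩
  A + (1 + n) * (n C k) + (1 + n) * (n C (1 + k)) ≡⟨ +-assoc A _ _ ⟩
  A + ((1 + n) * (n C k) + (1 + n) * (n C (1 + k))) ≡⟨ cong (A +_) (*-distribˡ-+ (1 + n) (n C k) (n C (1 + k))) ⟨
  A + (1 + n) * (n C k + n C (1 + k))             ≡⟨ cong (λ x → A + (1 + n) * x) (nCk+nC[k+1]≡[n+1]C[k+1] n k) ⟩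
  A + (1 + n) * A                               ∎
  where
  open ≡-Reasoning
  A = suc n C suc k
  B = suc n C (2 + k)

[1+k]*nC[1+k]≡[n∸k]*nCk : ∀ n k → suc k * (n C suc k) ≡ (n ∸ k) * (n C k)
[1+k]*nC[1+k]≡[n∸k]*nCk zero    k rewrite k>n⇒nCk≡0 {0} {suc k} (s≤s z≤n) | 0∸n≡0 k = *-zeroʳ (suc k)
[1+k]*nC[1+k]≡[n∸k]*nCk (suc n) zero    = [1+k]*[1+n]C[1+k]≡[1+n]*nCk n zero
[1+k]*nC[1+k]≡[n∸k]*nCk (suc n) (suc k) with suc k ≤? suc n
... | no  k≰n rewrite k>n⇒nCk≡0 {suc n} {2 + k} (m<n⇒m<1+n (≰⇒> k≰n)) | k>n⇒nCk≡0 {suc n} {suc k} (≰⇒> k≰n) =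
  trans (*-zeroʳ (2 + k)) (sym (*-zeroʳ (n ∸ k)))
... | yes k<n = +-cancelʳ-≡ ((1 + k) * A) _ _ $ begin
  (2 + k) * B + (1 + k) * A                 ≡⟨ cong₂ _+_ ([1+k]*[1+n]C[1+k]≡[1+n]*nCk n (suc k)) ([1+k]*[1+n]C[1+k]≡[1+n]*nCk n k) ⟩
  (1 + n) * (n C (1 + k)) + (1 + n) * (n C k) ≡⟨ +-comm ((1 + n) * (n C (1 + k))) _ ⟩
  (1 + n) * (n C k) + (1 + n) * (n C (1 + k)) ≡⟨ *-distribˡ-+ (1 + n) (n C k) (n C (1 + k)) ⟨
  (1 + n) * (n C k + n C (1 + k))             ≡⟨ cong ((1 + n) *_) (nCk+nC[k+1]≡[n+1]C[k+1] n k) ⟩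
  (1 + n) * A                               ≡⟨ cong (_* A) (m∸n+n≡m k<n) ⟨
  (n ∸ k + (1 + k)) * A                     ≡⟨ *-distribʳ-+ A (n ∸ k) (1 + k) ⟩
  (n ∸ k) * A + (1 + k) * A                 ∎
  where
  open ≡-Reasoning
  A = suc n C suc k
  B = suc n C (2 + k)

C-geometric : ∀ N {α γ a} → γ + α + a ≤ suc N → a ≤ α → Geometric (N C_) α γ a
C-geometric N bound a≤α = growth (C-grows bound a≤α)
  where
  C-grows : ∀ {α γ a j} → γ + α + a ≤ suc N → a ≤ α → j < a → N C j ≤[ α ÷ γ + α ] N C suc j
  C-grows {α} {γ} {a} {j} bound a≤α j<a = ratio $ begin
    (γ + α) * (N C j)      ≤⟨ *-monoˡ-≤ (N C j) (m+n≤o⇒m≤o∸n (γ + α) room) ⟩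
    (N ∸ j) * (N C j)      ≡⟨ [1+k]*nC[1+k]≡[n∸k]*nCk N j ⟨
    suc j * (N C suc j)    ≤⟨ *-monoˡ-≤ (N C suc j) (≤-trans j<a a≤α) ⟩
    α * (N C suc j)        ∎
    where
    open ≤-Reasoning
    room : γ + α + j ≤ N
    room = s≤s⁻¹ (≤-trans (≤-reflexive (sym (+-suc (γ + α) j))) (≤-trans (+-monoʳ-≤ (γ + α) j<a) bound))

C-increasing : ∀ N {j} → suc (j + j) ≤ N → N C j ≤ N C suc j
C-increasing N {j} le = *-cancelˡ-≤ (suc j) $ begin
  suc j * (N C j)        ≤⟨ *-monoˡ-≤ (N C j) (m+n≤o⇒m≤o∸n (suc j) le) ⟩
  (N ∸ j) * (N C j)      ≡⟨ [1+k]*nC[1+k]≡[n∸k]*nCk N j ⟨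
  suc j * (N C suc j)    ∎
  where open ≤-Reasoning

C-mono-≤ : ∀ N {a b} → a ≤ b → b + b ≤ suc N → N C a ≤ N C b
C-mono-≤ N {a} {zero}  z≤n  _ = ≤-refl
C-mono-≤ N {a} {suc b} a≤1+b le with m≤n⇒m<n∨m≡n a≤1+b
... | inj₂ refl = ≤-refl
... | inj₁ a<1+b = ≤-trans (C-mono-≤ N (s≤s⁻¹ a<1+b) (≤-trans (+-mono-≤ (n≤1+n b) (n≤1+n b)) le))
                           (C-increasing N (s≤s⁻¹ (≤-trans (≤-reflexive (cong suc (sym (+-suc b b)))) le)))

C-unimodal : ∀ N {f x} → f ≤ x → x ≤ N ∸ f → N C f ≤ N C x
C-unimodal N {f} {x} f≤x x≤N∸f with x + x ≤? suc N
... | yes le = C-mono-≤ N f≤x le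
... | no  gt = ≤-trans (C-mono-≤ N f≤N∸x (+-cancelʳ-≤ (x + x) _ _ twice)) (≤-reflexive (sym (nCk≡nC[n∸k] x≤N)))
  where
  open ≤-Reasoning
  x≤N : x ≤ N
  x≤N = ≤-trans x≤N∸f (m∸n≤m N f)
  f≤N∸x : f ≤ N ∸ x
  f≤N∸x = m+n≤o⇒m≤o∸n f (≤-trans (≤-reflexive (+-comm f x)) (≤-trans (+-monoˡ-≤ f x≤N∸f) (≤-reflexive (m∸n+n≡m (≤-trans f≤x x≤N)))))
  twice : (N ∸ x) + (N ∸ x) + (x + x) ≤ suc N + (x + x)
  twice = begin
    (N ∸ x) + (N ∸ x) + (x + x)   ≡⟨ +-CS.interchange (N ∸ x) (N ∸ x) x x ⟩
    (N ∸ x + x) + (N ∸ x + x)     ≡⟨ cong₂ _+_ (m∸n+n≡m x≤N) (m∸n+n≡m x≤N) ⟩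
    N + N                         ≤⟨ +-monoʳ-≤ N (≤-trans (n≤1+n N) (<⇒≤ (≰⇒> gt))) ⟩
    N + (x + x)                   ≤⟨ +-monoˡ-≤ (x + x) (n≤1+n N) ⟩
    suc N + (x + x)               ∎

-- Polynomial inequalities

-- Each inequality is certified by writing its right-hand side as the left-hand side
-- plus a polynomial with nonnegative coefficients.

nondivisible-certificate₁ : ∀ f′ r D′ →
  let f = suc f′ ; D = suc D′ ; γ = suc (r + f * (r + D)) ; d = suc (suc D) ; P = r + f * suc (r + D) in
  (d * (((2 + suc r) * f + suc r * γ) * f) + γ * (γ + f) * (r * 1)) * suc f
    + (6 + 44 * D′ + 54 * r + 9 * f′ + 35 * D′ * D′ + 90 * r * D′ + 52 * r * r + 105 * f′ * D′ +
      103 * f′ * r + 3 * f′ * f′ + 10 * D′ * D′ * D′ + 42 * r * D′ * D′ + 52 * r * r * D′ + 16 * r * r * r +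
      91 * f′ * D′ * D′ + 191 * f′ * r * D′ + 88 * f′ * r * r + 82 * f′ * f′ * D′ + 64 * f′ * f′ * r +
      D′ * D′ * D′ * D′ + 6 * r * D′ * D′ * D′ + 12 * r * r * D′ * D′ + 8 * r * r * r * D′ +
      28 * f′ * D′ * D′ * D′ + 97 * f′ * r * D′ * D′ + 96 * f′ * r * r * D′ + 24 * f′ * r * r * r +
      78 * f′ * f′ * D′ * D′ + 131 * f′ * f′ * r * D′ + 49 * f′ * f′ * r * r + 21 * f′ * f′ * f′ * D′ +
      13 * f′ * f′ * f′ * r + 3 * f′ * D′ * D′ * D′ * D′ + 15 * f′ * r * D′ * D′ * D′ +
      24 * f′ * r * r * D′ * D′ + 12 * f′ * r * r * r * D′ + 26 * f′ * f′ * D′ * D′ * D′ +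
      72 * f′ * f′ * r * D′ * D′ + 57 * f′ * f′ * r * r * D′ + 12 * f′ * f′ * r * r * r +
      22 * f′ * f′ * f′ * D′ * D′ + 29 * f′ * f′ * f′ * r * D′ + 9 * f′ * f′ * f′ * r * r +
      3 * f′ * f′ * D′ * D′ * D′ * D′ + 12 * f′ * f′ * r * D′ * D′ * D′ + 15 * f′ * f′ * r * r * D′ * D′ +
      6 * f′ * f′ * r * r * r * D′ + 8 * f′ * f′ * f′ * D′ * D′ * D′ + 17 * f′ * f′ * f′ * r * D′ * D′ +
      11 * f′ * f′ * f′ * r * r * D′ + 2 * f′ * f′ * f′ * r * r * r + f′ * f′ * f′ * D′ * D′ * D′ * D′ +
      3 * f′ * f′ * f′ * r * D′ * D′ * D′ + 3 * f′ * f′ * f′ * r * r * D′ * D′ +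
      f′ * f′ * f′ * r * r * r * D′)
    ≡ γ * (γ + f) * d * P
nondivisible-certificate₁ = solve-∀

nondivisible-certificate₂ : ∀ f′ r′ →
  let f = suc f′ ; r = suc (suc r′) ; γ = suc (r + f * (r + 0)) ; P = r + f * suc (r + 0) in
  (2 * (((2 + suc r) * f + suc r * γ) * f) + γ * (γ + f) * (r * 1)) * suc f
    + (100 + 144 * r′ + 118 * f′ + 60 * r′ * r′ + 202 * f′ * r′ + 38 * f′ * f′ + 8 * r′ * r′ * r′ +
      88 * f′ * r′ * r′ + 93 * f′ * f′ * r′ + 2 * f′ * f′ * f′ + 12 * f′ * r′ * r′ * r′ +
      43 * f′ * f′ * r′ * r′ + 14 * f′ * f′ * f′ * r′ + 6 * f′ * f′ * r′ * r′ * r′ +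
      7 * f′ * f′ * f′ * r′ * r′ + f′ * f′ * f′ * r′ * r′ * r′)
    ≡ γ * (γ + f) * 2 * P
nondivisible-certificate₂ = solve-∀

nondivisible-inequality : ∀ f′ r D → 1 ≤ D ⊎ 2 ≤ r →
  let f = suc f′ ; γ = suc (r + f * (r + D)) ; d = suc (suc D) ; P = r + f * suc (r + D) in
  (d * (((2 + suc r) * f + suc r * γ) * f) + γ * (γ + f) * (r * 1)) * suc f ≤ γ * (γ + f) * d * P
nondivisible-inequality f′ r (suc D′) _ = ≤-trans (m≤m+n _ _) (≤-reflexive (nondivisible-certificate₁ f′ r D′))
nondivisible-inequality f′ (suc (suc r′)) zero _ = ≤-trans (m≤m+n _ _) (≤-reflexive (nondivisible-certificate₂ f′ r′))
nondivisible-inequality f′ zero          zero (inj₂ ())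
nondivisible-inequality f′ (suc zero)    zero (inj₂ (s≤s ()))
nondivisible-inequality f′ r             zero (inj₁ ())

nondivisible-certificate₃ : ∀ f′ →
  let f = suc f′ ; β = suc (1 + f * 1) + f ; P = 1 + f * 2 in
  (2 * (f * f + β * (2 * f)) + β * β * (1 * 1)) * suc f + (28 + 38 * f′ + 16 * f′ * f′ + 2 * f′ * f′ * f′)
    ≡ β * β * 2 * P
nondivisible-certificate₃ = solve-∀

nondivisible-inequality-v≡3 : ∀ f′ →
  let f = suc f′ ; β = suc (1 + f * 1) + f ; P = 1 + f * 2 in
  (2 * (f * f + β * (2 * f)) + β * β * (1 * 1)) * suc f ≤ β * β * 2 * P
nondivisible-inequality-v≡3 f′ = ≤-trans (m≤m+n _ _) (≤-reflexive (nondivisible-certificate₃ f′))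

divisible-certificate : ∀ g k →
  let f′ = suc g ; f = suc f′ ; m′ = suc k ; m = suc m′ ; γ = suc (suc (f * m′)) ; P = m′ + f′ * m in
  ((suc (suc m) * (2 * f′) + 1 * (m′ * f′ + γ)) * 1) * suc f
    + (57 + 169 * k + 45 * g + 128 * k * k + 153 * g * k + 6 * g * g + 38 * k * k * k + 121 * g * k * k +
      32 * g * g * k + 4 * k * k * k * k + 37 * g * k * k * k + 28 * g * g * k * k + 4 * g * k * k * k * k +
      9 * g * g * k * k * k + g * g * k * k * k * k)
    ≡ suc (suc m) * γ * m * P
divisible-certificate = solve-∀

divisible-inequality : ∀ g k →
  let f′ = suc g ; f = suc f′ ; m′ = suc k ; m = suc m′ ; γ = suc (suc (f * m′)) ; P = m′ + f′ * m in
  ((suc (suc m) * (2 * f′) + 1 * (m′ * f′ + γ)) * 1) * suc f ≤ suc (suc m) * γ * m * P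
divisible-inequality g k = ≤-trans (m≤m+n _ _) (≤-reflexive (divisible-certificate g k))

module Counts (N m′ : ℕ) where

  m : ℕ
  m = suc m′

  open BalancedCount m

  length-Lshape : ∀ i → length (Lshape N (suc m) i) ≡ suc m
  length-Lshape i = cong suc $ begin
    length (replicate r (suc q) ++ replicate (m ∸ r) q)  ≡⟨ length-++ (replicate r (suc q)) ⟩
    length (replicate r (suc q)) + length (replicate (m ∸ r) q)
                                                         ≡⟨ cong₂ _+_ (length-replicate r) (length-replicate (m ∸ r)) ⟩
    r + (m ∸ r)                                          ≡⟨ m+[n∸m]≡n (<⇒≤ (m%n<n (N ∸ i) m)) ⟩
    m                                                    ∎
    where
    open ≡-Reasoning
    q = (N ∸ i) / m
    r = (N ∸ i) % m

  T : ℕ → ℕ → ℕ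
  T x i = μ (balanced m (N ∸ i)) x

  -- L_i is i followed by the balanced partition of N - i into m parts, definitionally
  μ-Lshape : ∀ i x → μ (Lshape N (suc m) i) x ≡ δ i x + T x i
  μ-Lshape i x = μ-∷ i (balanced m (N ∸ i)) x

  T-≤ : ∀ x i → T x i ≤ m
  T-≤ x i = μ-balanced-≤ (N ∸ i) x

  T-≤-below : ∀ x i e → suc x * m ≤ (N ∸ i) + e → T x i ≤ e
  T-≤-below x i e = μ-balanced-≤-below (N ∸ i) x e

  T-≤-above : ∀ x i e → (N ∸ i) + m ≤ x * m + e → T x i ≤ e
  T-≤-above x i e = μ-balanced-≤-above (N ∸ i) x e

  T≡0-below : ∀ x i → suc x * m ≤ N ∸ i → T x i ≡ 0
  T≡0-below x i le = n≤0⇒n≡0 (T-≤-below x i 0 (≤-trans le (≤-reflexive (sym (+-identityʳ (N ∸ i))))))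

  T≡0-above : ∀ x i → (N ∸ i) + m ≤ x * m → T x i ≡ 0
  T≡0-above x i le = n≤0⇒n≡0 (T-≤-above x i 0 (≤-trans le (≤-reflexive (sym (+-identityʳ (x * m))))))

  c : ℕ → ℕ
  c i = N C i

  c-ratio : ∀ j → c j ≤[ suc j ÷ N ∸ j ] c (suc j)
  c-ratio j = ratio (≤-reflexive (sym ([1+k]*nC[1+k]≡[n∸k]*nCk N j)))

  prefix : ℕ → ℕ → ℕ
  prefix a x = ∑[ i < a ] (c i * μ (Lshape N (suc m) i) x)

  prefix-split : ∀ a x → prefix a x ≡ ∑[ i < a ] (c i * δ i x) + ∑[ i < a ] (c i * T x i)
  prefix-split a x = trans (∑-cong a (λ {i} _ → trans (cong (c i *_) (μ-Lshape i x)) (*-distribˡ-+ (c i) (δ i x) (T x i))))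
                           (∑-distrib-+ a)

  prefix-below : ∀ a x → x < a → (∀ {i} → i < a → T x i ≡ 0) → prefix a x ≡ c x
  prefix-below a x x<a T≡0 = begin
    prefix a x                                          ≡⟨ prefix-split a x ⟩
    ∑[ i < a ] (c i * δ i x) + ∑[ i < a ] (c i * T x i)
      ≡⟨ cong₂ _+_ (∑-δ-< c a x<a) (∑-zero a (λ {i} i<a → trans (cong (c i *_) (T≡0 i<a)) (*-zeroʳ (c i)))) ⟩
    c x + 0                                             ≡⟨ +-identityʳ (c x) ⟩
    c x                                                 ∎
    where open ≡-Reasoning

  prefix-above : ∀ a x → a ≤ x → prefix a x ≡ ∑[ i < a ] (c i * T x i)
  prefix-above a x a≤x = trans (prefix-split a x) (cong (_+ ∑[ i < a ] (c i * T x i)) (∑-δ-≥ c a a≤x))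

  ∑-T-≤ : ∀ a x (w : ℕ → ℕ) → (∀ {i} → i < a → T x i ≤ w i) → ∑[ i < a ] (c i * T x i) ≤ ∑[ i < a ] (c i * w i)
  ∑-T-≤ a x w le = ∑-mono-≤ a (λ {i} i<a → *-monoʳ-≤ (c i) (le i<a))

  -- Here a = f - 1.  The counts are at most m and vanish once x exceeds N - f;
  -- below that, C(N, f) ≤ C(N, x) by unimodality.
  tail-≤ : ∀ {a x} → 1 ≤ m′ → suc a + suc a ≤ N → m * ∑< a c ≤ c (suc a) → suc a ≤ x →
           ∑[ i < a ] (c i * T x i) ≤ c x
  tail-≤ {a} {x} 1≤m′ room m∑≤ f≤x with x ≤? N ∸ suc a
  ... | yes x≤N∸f = begin
    ∑[ i < a ] (c i * T x i)   ≤⟨ ∑-T-≤ a x (λ _ → m) (λ {i} _ → T-≤ x i) ⟩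
    ∑[ i < a ] (c i * m)       ≡⟨ trans (∑-cong a (λ {i} _ → *-comm (c i) m)) (sym (*-distribˡ-∑ m c a)) ⟩
    m * ∑< a c                 ≤⟨ m∑≤ ⟩
    c (suc a)                  ≤⟨ C-unimodal N f≤x x≤N∸f ⟩
    c x                        ∎
    where open ≤-Reasoning
  ... | no  x≰N∸f = ≤-trans (≤-reflexive (∑-zero a (λ {i} _ → trans (cong (c i *_) (T≡0-above x i (vanish i))) (*-zeroʳ (c i))))) z≤n
    where
    open ≤-Reasoning
    f = suc a
    f≤N∸f : f ≤ N ∸ f
    f≤N∸f = m+n≤o⇒m≤o∸n f room
    vanish : ∀ i → (N ∸ i) + m ≤ x * m
    vanish i = begin
      (N ∸ i) + m                 ≤⟨ +-monoˡ-≤ m (m∸n≤m N i) ⟩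
      N + m                       ≡⟨ cong (_+ m) (m∸n+n≡m (≤-trans f≤N∸f (m∸n≤m N f))) ⟨
      (N ∸ f) + f + m             ≤⟨ +-monoˡ-≤ m (+-monoʳ-≤ (N ∸ f) f≤N∸f) ⟩
      (N ∸ f) + (N ∸ f) + m       ≡⟨ cong (λ z → (N ∸ f) + z + m) (+-identityʳ (N ∸ f)) ⟨
      2 * (N ∸ f) + m             ≤⟨ +-monoˡ-≤ m (*-monoˡ-≤ (N ∸ f) (s≤s 1≤m′)) ⟩
      m * (N ∸ f) + m             ≡⟨ trans (+-comm (m * (N ∸ f)) m) (cong (m +_) (*-comm m (N ∸ f))) ⟩
      suc (N ∸ f) * m             ≤⟨ *-monoˡ-≤ m (≰⇒> x≰N∸f) ⟩
      x * m                       ∎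

-- The case v ∤ N + 1

-- N + 1 = f v + (r + 1) with 0 ≤ r ≤ v - 2, v = m + 1, m = m′ + 1 = r + D + 1, so that d = D + 2
module NonDivisible (f′ r D : ℕ) where

  m′ f N : ℕ
  m′ = r + D
  f  = suc f′
  N  = r + f * suc (suc m′)

  open Counts N m′ public

  d α γ P s mult : ℕ
  d = suc (suc D)
  α = f
  γ = suc (r + f * m′)   -- γ + α = N - f + 1, so C(N, j + 1)/C(N, j) ≥ (γ + α)/α for j < f
  P = r + f * m
  s = ramp c f D
  mult = (c f ∸ s) / d

  count : ℕ → ℕ
  count x = prefix f x + mult * μ (Lshape N (suc m) f) x

  N≡ : N ≡ f + (r + f * m)
  N≡ = shuffle f r m′
    where
    shuffle : ∀ f r m′ → r + f * suc (suc m′) ≡ f + (r + f * suc m′)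
    shuffle = solve-∀

  N∸i≡ : ∀ {i} → i ≤ f → N ∸ i ≡ (f ∸ i) + P
  N∸i≡ {i} i≤f = trans (cong (_∸ i) N≡) (+-∸-comm P i≤f)

  N∸f≡P : N ∸ f ≡ P
  N∸f≡P = trans (N∸i≡ ≤-refl) (cong (_+ P) (n∸n≡0 f))

  geometric : Geometric c α γ f
  geometric = C-geometric N {α} {γ} {f} (≤-reflexive (regroup f r m′)) ≤-refl
    where
    regroup : ∀ f r m′ → suc (r + f * m′) + f + f ≡ suc (r + f * suc (suc m′))
    regroup = solve-∀

  αm′≤γ : α * m′ ≤ γ
  αm′≤γ = ≤-trans (m≤n+m (f * m′) r) (n≤1+n _)

  α≤γ : 1 ≤ m′ → α ≤ γ
  α≤γ 1≤m′ = ≤-trans (≤-trans (≤-reflexive (sym (*-identityʳ f))) (*-monoʳ-≤ f 1≤m′)) αm′≤γ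

  s≤cf : s ≤ c f
  s≤cf = ≤[÷]⇒≤ (≤-trans (*-monoˡ-≤ α (m≤n+m D r)) (≤-trans (≤-reflexive (*-comm m′ α)) αm′≤γ))
                (ramp-geometric D geometric)

  d*mult≤ : d * mult ≤ c f ∸ s
  d*mult≤ = ≤-trans (≤-reflexive (*-comm d mult)) (m/n*n≤m (c f ∸ s) d)

  T≡0-low : ∀ {x i} → x < f → i ≤ f → T x i ≡ 0
  T≡0-low {x} {i} x<f i≤f = T≡0-below x i $ begin
    suc x * m         ≤⟨ *-monoˡ-≤ m x<f ⟩
    f * m             ≤⟨ m≤n+m (f * m) (f ∸ i + r) ⟩
    f ∸ i + r + f * m ≡⟨ +-assoc (f ∸ i) r (f * m) ⟩
    f ∸ i + P         ≡⟨ N∸i≡ i≤f ⟨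
    N ∸ i             ∎
    where open ≤-Reasoning

  count-below : ∀ {x} → x < f → count x ≡ c x
  count-below {x} x<f = begin
    prefix f x + mult * μ (Lshape N (suc m) f) x  ≡⟨ cong₂ _+_ (prefix-below f x x<f (T≡0-low x<f ∘′ <⇒≤)) (cong (mult *_) (μ-Lshape f x)) ⟩
    c x + mult * (δ f x + T x f)                  ≡⟨ cong₂ (λ a b → c x + mult * (a + b)) (δ-≢ (<⇒≢ x<f ∘′ sym)) (T≡0-low x<f ≤-refl) ⟩
    c x + mult * 0                                ≡⟨ trans (cong (c x +_) (*-zeroʳ mult)) (+-identityʳ (c x)) ⟩
    c x                                           ∎
    where open ≡-Reasoning

  T-≤-ramp : ∀ {i} → i ≤ f → T f i ≤ suc D ∸ (f ∸ i)
  T-≤-ramp {i} i≤f = T-≤-below f i (suc D ∸ (f ∸ i)) $ begin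
    m + f * m                             ≡⟨ regroup r D f ⟩
    suc D + P                             ≤⟨ +-monoˡ-≤ P (m≤n+m∸n (suc D) (f ∸ i)) ⟩
    f ∸ i + (suc D ∸ (f ∸ i)) + P         ≡⟨ +-CS.xy∙z≈xz∙y (f ∸ i) (suc D ∸ (f ∸ i)) P ⟩
    f ∸ i + P + (suc D ∸ (f ∸ i))         ≡⟨ cong (_+ (suc D ∸ (f ∸ i))) (N∸i≡ i≤f) ⟨
    N ∸ i + (suc D ∸ (f ∸ i))             ∎
    where
    open ≤-Reasoning
    regroup : ∀ r D f → suc (r + D) + f * suc (r + D) ≡ suc D + (r + f * suc (r + D))
    regroup = solve-∀

  count-at-f : count f ≤ c f
  count-at-f = begin
    prefix f f + mult * μ (Lshape N (suc m) f) f  ≡⟨ cong₂ _+_ (prefix-above f f ≤-refl) (cong (mult *_) (μ-Lshape f f)) ⟩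
    ∑[ i < f ] (c i * T f i) + mult * (δ f f + T f f)
      ≤⟨ +-mono-≤ (∑-T-≤ f f (λ i → suc D ∸ (f ∸ i)) (T-≤-ramp ∘′ <⇒≤))
                  (*-monoʳ-≤ mult (+-mono-≤ (≤-reflexive (δ-refl f)) (≤-trans (T-≤-ramp ≤-refl) (m∸n≤m (suc D) (f ∸ f))))) ⟩
    s + mult * d                                  ≤⟨ +-monoʳ-≤ s (≤-trans (≤-reflexive (*-comm mult d)) d*mult≤) ⟩
    s + (c f ∸ s)                                 ≡⟨ m+[n∸m]≡n s≤cf ⟩
    c f                                           ∎
    where open ≤-Reasoning

  T≡0-high : ∀ {x i} → suc (suc f) ≤ x → f′ ≤ i → T x i ≡ 0
  T≡0-high {x} {i} 2+f≤x f′≤i = T≡0-above x i $ begin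
    N ∸ i + m             ≤⟨ +-monoˡ-≤ m (∸-monoʳ-≤ N f′≤i) ⟩
    N ∸ f′ + m            ≡⟨ cong (_+ m) (trans (N∸i≡ (n≤1+n f′)) (cong (_+ P) (m+n∸n≡m 1 f′))) ⟩
    suc P + m             ≤⟨ m≤m+n (suc P + m) D ⟩
    suc P + m + D   ≡⟨ regroup r D f ⟩
    suc (suc f) * m       ≤⟨ *-monoˡ-≤ m 2+f≤x ⟩
    x * m                 ∎
    where
    open ≤-Reasoning
    regroup : ∀ r D f → suc (r + f * suc (r + D)) + suc (r + D) + D ≡ suc (suc f) * suc (r + D)
    regroup = solve-∀

  count-above : 1 ≤ m′ → ∀ {x} → suc (suc f) ≤ x → count x ≤ c x
  count-above 1≤m′ {x} 2+f≤x = begin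
    prefix f x + mult * μ (Lshape N (suc m) f) x
      ≡⟨ cong₂ _+_ (prefix-above f x f≤x) (cong (mult *_) (μ-Lshape f x)) ⟩
    ∑[ i < f′ ] (c i * T x i) + c f′ * T x f′ + mult * (δ f x + T x f)
      ≡⟨ cong₃ (λ a b t → ∑[ i < f′ ] (c i * T x i) + c f′ * a + mult * (b + t))
               (T≡0-high 2+f≤x ≤-refl) (δ-≢ (<⇒≢ (<-trans (n<1+n f) 2+f≤x))) (T≡0-high 2+f≤x (n≤1+n f′)) ⟩
    ∑[ i < f′ ] (c i * T x i) + c f′ * 0 + mult * 0
      ≡⟨ trans (cong₂ (λ a b → ∑[ i < f′ ] (c i * T x i) + a + b) (*-zeroʳ (c f′)) (*-zeroʳ mult)) (trans (+-identityʳ _) (+-identityʳ _)) ⟩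
    ∑[ i < f′ ] (c i * T x i)
      ≤⟨ tail-≤ 1≤m′ room (∑-geometric-tail m′ αm′≤γ (α≤γ 1≤m′) geometric) f≤x ⟩
    c x ∎
    where
    open ≤-Reasoning
    f≤x : f ≤ x
    f≤x = ≤-trans (n≤1+n f) (<⇒≤ 2+f≤x)
    room : f + f ≤ N
    room = ≤-trans (+-monoʳ-≤ f (≤-trans (m≤m*n f m) (m≤n+m (f * m) r))) (≤-reflexive (sym N≡))

  T-≤-linear : ∀ {i} → i ≤ f → T (suc f) i ≤ r + (f ∸ i)
  T-≤-linear {i} i≤f = T-≤-above (suc f) i (r + (f ∸ i)) $ begin
    N ∸ i + m                   ≡⟨ cong (_+ m) (N∸i≡ i≤f) ⟩
    f ∸ i + P + m               ≡⟨ regroup (f ∸ i) r f m ⟩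
    suc f * m + (r + (f ∸ i))   ∎
    where
    open ≤-Reasoning
    regroup : ∀ j r f m → j + (r + f * m) + m ≡ suc f * m + (r + j)
    regroup = solve-∀

  T-≤-ramp′ : ∀ {i} → i ≤ f → T (suc f) i ≤ suc (m + D) ∸ (f ∸ i)
  T-≤-ramp′ {i} i≤f = T-≤-below (suc f) i (suc (m + D) ∸ (f ∸ i)) $ begin
    suc (suc f) * m                               ≡⟨ regroup r D f ⟩
    r + suc (m + D) + f * m                       ≤⟨ +-monoˡ-≤ (f * m) (+-monoʳ-≤ r (m≤n+m∸n (suc (m + D)) (f ∸ i))) ⟩
    r + (f ∸ i + (suc (m + D) ∸ (f ∸ i))) + f * m ≡⟨ shuffle r (f ∸ i) (suc (m + D) ∸ (f ∸ i)) (f * m) ⟩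
    f ∸ i + P + (suc (m + D) ∸ (f ∸ i))           ≡⟨ cong (_+ (suc (m + D) ∸ (f ∸ i))) (N∸i≡ i≤f) ⟨
    N ∸ i + (suc (m + D) ∸ (f ∸ i))               ∎
    where
    open ≤-Reasoning
    regroup : ∀ r D f → suc (suc f) * suc (r + D) ≡ r + suc (suc (r + D) + D) + f * suc (r + D)
    regroup = solve-∀
    shuffle : ∀ r j k fm → r + (j + k) + fm ≡ j + (r + fm) + k
    shuffle = solve-∀

  T-1+f-f≤r : T (suc f) f ≤ r
  T-1+f-f≤r = ≤-trans (T-≤-linear ≤-refl) (≤-reflexive (trans (cong (r +_) (n∸n≡0 f)) (+-identityʳ r)))

  count-at-1+f : count (suc f) ≡ ∑[ i < f ] (c i * T (suc f) i) + mult * T (suc f) f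
  count-at-1+f = cong₂ _+_ (prefix-above f (suc f) (n≤1+n f))
    (trans (cong (mult *_) (μ-Lshape f (suc f))) (cong (λ a → mult * (a + T (suc f) f)) (δ-≢ (<⇒≢ (n<1+n f)))))

  count-at-1+f-≤-linear : count (suc f) ≤ linear c f r + r * mult
  count-at-1+f-≤-linear = begin
    count (suc f)                                          ≡⟨ count-at-1+f ⟩
    ∑[ i < f ] (c i * T (suc f) i) + mult * T (suc f) f    ≤⟨ +-mono-≤ (∑-T-≤ f (suc f) (λ i → r + (f ∸ i)) (T-≤-linear ∘′ <⇒≤))
                                                                       (*-monoʳ-≤ mult T-1+f-f≤r) ⟩
    linear c f r + mult * r                                ≡⟨ cong (linear c f r +_) (*-comm mult r) ⟩
    linear c f r + r * mult                                ∎
    where open ≤-Reasoning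

  count-at-1+f-≤-ramp : count (suc f) ≤ ramp c f (m + D) + r * mult
  count-at-1+f-≤-ramp = begin
    count (suc f)                                          ≡⟨ count-at-1+f ⟩
    ∑[ i < f ] (c i * T (suc f) i) + mult * T (suc f) f    ≤⟨ +-mono-≤ (∑-T-≤ f (suc f) (λ i → suc (m + D) ∸ (f ∸ i)) (T-≤-ramp′ ∘′ <⇒≤))
                                                                       (*-monoʳ-≤ mult T-1+f-f≤r) ⟩
    ramp c f (m + D) + mult * r                            ≡⟨ cong (ramp c f (m + D) +_) (*-comm mult r) ⟩
    ramp c f (m + D) + r * mult                            ∎
    where open ≤-Reasoning

  c-f≤c-1+f : c f ≤[ suc f ÷ P ] c (suc f)
  c-f≤c-1+f = subst (λ p → c f ≤[ suc f ÷ p ] c (suc f)) N∸f≡P (c-ratio f)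

  mult≤ : r * mult ≤[ r * 1 ÷ d ] c f
  mult≤ = ≤[÷]-scale r (ratio (≤-trans d*mult≤ (≤-trans (m∸n≤m (c f) s) (≤-reflexive (sym (*-identityˡ (c f)))))))

  module _ (1≤m′ : 1 ≤ m′) where

    linear-bound : linear c f r + r * mult
      ≤[ (d * (((2 + suc r) * α + suc r * γ) * α) + γ * (γ + α) * (r * 1)) * suc f ÷ γ * (γ + α) * d * P ] c (suc f)
    linear-bound = ≤[÷]-congˡ (sym (cong₂ _+_ (trans (linear-suc c f′ r) (cong (linear c f′ (suc r) +_) (*-comm (c f′) (suc r)))) refl))
      (≤[÷]-compose
        (≤[÷]-+′ (≤[÷]-compose (≤[÷]-+ (linear-geometric (α≤γ 1≤m′) (suc r) (geometric-≤ (n≤1+n f′) geometric))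
                                       (≤[÷]-scale (suc r) (≤[÷]-refl γ (c f′))))
                               (grows geometric ≤-refl))
                 mult≤)
        c-f≤c-1+f)

    count-at-1+f-≤ : 1 ≤ D ⊎ 2 ≤ r → count (suc f) ≤ c (suc f)
    count-at-1+f-≤ h = ≤-trans count-at-1+f-≤-linear
      (≤[÷]⇒≤ {{m*n≢0 (γ * (γ + α) * d) P {{_}} {{P≢0}}}} (nondivisible-inequality f′ r D h) linear-bound)
      where
      P≢0 : NonZero P
      P≢0 = >-nonZero (≤-trans (s≤s z≤n) (m≤n+m (f * m) r))

-- For v = 3 and N ≡ 1 (mod 3) the multiplicity of L_f is about C(N, f)/2 and the
-- linear weights r + f - i are too generous; the other side of the tent gives 2, 1, 0, ….
count-at-1+f-v≡3 : ∀ f′ → NonDivisible.count f′ 1 0 (2 + f′) ≤ NonDivisible.N f′ 1 0 C (2 + f′)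
count-at-1+f-v≡3 f′ = ≤-trans count-at-1+f-≤-ramp
  (≤[÷]⇒≤ (nondivisible-inequality-v≡3 f′) (≤[÷]-compose (≤[÷]-+′ (ramp₂-geometric geometric) mult≤) c-f≤c-1+f))
  where open NonDivisible f′ 1 0

nondivisible-count-≤ : ∀ f′ r D → 1 ≤ r + D → ∀ x → NonDivisible.count f′ r D x ≤ NonDivisible.N f′ r D C x
nondivisible-count-≤ f′ r D 1≤m′ x with <-cmp x (suc f′)
... | tri< x<f _ _  = ≤-reflexive (NonDivisible.count-below f′ r D x<f)
... | tri≈ _ refl _ = NonDivisible.count-at-f f′ r D
... | tri> _ _ f<x with m≤n⇒m<n∨m≡n f<x
...   | inj₂ refl    = at-1+f r D 1≤m′
  where
  at-1+f : ∀ r D → 1 ≤ r + D → NonDivisible.count f′ r D (2 + f′) ≤ NonDivisible.N f′ r D C (2 + f′)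
  at-1+f r             (suc D) 1≤m′ = NonDivisible.count-at-1+f-≤ f′ r (suc D) 1≤m′ (inj₁ (s≤s z≤n))
  at-1+f (suc (suc r)) zero    1≤m′ = NonDivisible.count-at-1+f-≤ f′ (2 + r) 0 1≤m′ (inj₂ (s≤s (s≤s z≤n)))
  at-1+f 1             zero    _    = count-at-1+f-v≡3 f′
  at-1+f zero          zero    ()
...   | inj₁ 1+f<x   = NonDivisible.count-above f′ r D 1≤m′ 1+f<x

-- The case v ∣ N + 1

⌈_/suc_⌉ : ℕ → ℕ → ℕ
⌈ zero  /suc M ⌉ = 0
⌈ suc s /suc M ⌉ = suc (s / suc M)

≤⌈/suc⌉* : ∀ s M → s ≤ ⌈ s /suc M ⌉ * suc M
≤⌈/suc⌉* zero    M = z≤n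
≤⌈/suc⌉* (suc s) M = begin
  suc s                                   ≡⟨ cong suc (m≡m%n+[m/n]*n s (suc M)) ⟩
  suc (s % suc M + s / suc M * suc M)     ≤⟨ +-monoˡ-≤ (s / suc M * suc M) (m%n<n s (suc M)) ⟩
  suc M + s / suc M * suc M               ∎
  where open ≤-Reasoning

⌈/suc⌉*≤ : ∀ s M → ⌈ s /suc M ⌉ * suc M ≤ s + M
⌈/suc⌉*≤ zero    M = z≤n
⌈/suc⌉*≤ (suc s) M = begin
  suc M + s / suc M * suc M   ≤⟨ +-monoʳ-≤ (suc M) (m/n*n≤m s (suc M)) ⟩
  suc M + s                   ≡⟨ trans (+-comm (suc M) s) (+-suc s M) ⟩
  suc s + M                   ∎
  where open ≤-Reasoning

-- N + 1 = f v with f = g + 2 and v = m + 1 = k + 3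
module Divisible (g k : ℕ) where

  f′ f m′ N : ℕ
  f′ = suc g
  f  = suc f′
  m′ = suc k
  N  = f′ + f * suc m′

  open Counts N m′ public

  v α γ P s′ mult⋆ mult′ : ℕ
  v  = suc m
  α  = f′
  γ  = suc (suc (f * m′))   -- γ + α = N - f′ + 1, the growth ratio of C(N, _) below f′
  P  = m′ + f′ * m
  s′ = ramp c f′ m′
  mult⋆ = ⌈ s′ /suc v ⌉
  mult′ = c f′ ∸ 2 * mult⋆

  L⋆ : List ℕ
  L⋆ = replicate 2 f′ ++ (replicate k f ++ (suc f ∷ []))

  count : ℕ → ℕ
  count x = prefix f′ x + mult′ * μ (Lshape N v f′) x + mult⋆ * μ L⋆ x

  μ-L⋆ : ∀ x → μ L⋆ x ≡ 2 * δ f′ x + k * δ f x + δ (suc f) x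
  μ-L⋆ x = begin
    μ (replicate 2 f′ ++ (replicate k f ++ (suc f ∷ []))) x         ≡⟨ μ-++ (replicate 2 f′) _ x ⟩
    μ (replicate 2 f′) x + μ (replicate k f ++ (suc f ∷ [])) x      ≡⟨ cong₂ _+_ (μ-replicate 2 f′ x) (μ-++ (replicate k f) _ x) ⟩
    2 * δ f′ x + (μ (replicate k f) x + μ (suc f ∷ []) x)           ≡⟨ cong₂ (λ a b → 2 * δ f′ x + (a + b)) (μ-replicate k f x) (μ-∷ (suc f) [] x) ⟩
    2 * δ f′ x + (k * δ f x + (δ (suc f) x + 0))                   ≡⟨ tidy (2 * δ f′ x) (k * δ f x) (δ (suc f) x) ⟩
    2 * δ f′ x + k * δ f x + δ (suc f) x                           ∎
    where
    open ≡-Reasoning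
    tidy : ∀ a b e → a + (b + (e + 0)) ≡ a + b + e
    tidy = solve-∀

  length-L⋆ : length L⋆ ≡ v
  length-L⋆ = begin
    length (replicate 2 f′ ++ (replicate k f ++ (suc f ∷ [])))         ≡⟨ length-++ (replicate 2 f′) {replicate k f ++ (suc f ∷ [])} ⟩
    length (replicate 2 f′) + length (replicate k f ++ (suc f ∷ []))   ≡⟨ cong₂ _+_ (length-replicate 2 {f′})
                                                                           (length-++ (replicate k f) {suc f ∷ []}) ⟩
    2 + (length (replicate k f) + 1)                                   ≡⟨ cong (λ z → 2 + (z + 1)) (length-replicate k {f}) ⟩
    2 + (k + 1)                                                        ≡⟨ cong (2 +_) (+-comm k 1) ⟩
    v                                                                  ∎
    where open ≡-Reasoning

  N∸i≡ : ∀ {i} → i ≤ f′ → N ∸ i ≡ (f′ ∸ i) + f * m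
  N∸i≡ i≤f′ = +-∸-comm (f * m) i≤f′

  N∸f≡P : N ∸ f ≡ P
  N∸f≡P = trans (cong (_∸ f) (regroup g k)) (m+n∸n≡m P f)
    where
    regroup : ∀ g k → suc g + 2+ g * suc (suc k) ≡ suc k + suc g * suc (suc k) + 2+ g
    regroup = solve-∀

  geometric : Geometric c α γ f′
  geometric = C-geometric N {α} {γ} {f′} (≤-reflexive (regroup g k)) ≤-refl
    where
    regroup : ∀ g k → suc (suc (2+ g * suc k)) + suc g + suc g ≡ suc (suc g + 2+ g * suc (suc k))
    regroup = solve-∀

  α≤γ : α ≤ γ
  α≤γ = ≤-trans (n≤1+n f′) (≤-trans (m≤m*n f m′) (≤-trans (n≤1+n _) (n≤1+n _)))

  s′≤c-f′ : s′ ≤ c f′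
  s′≤c-f′ = ≤[÷]⇒≤ (≤-trans (≤-reflexive (*-comm m′ α)) (≤-trans (*-monoˡ-≤ m′ (n≤1+n f′)) (≤-trans (n≤1+n _) (n≤1+n _))))
                   (ramp-geometric m′ geometric)

  c-f≡m*c-f′ : c f ≡ m * c f′
  c-f≡m*c-f′ = *-cancelˡ-≡ (c f) (m * c f′) f $ begin
    f * c f                   ≡⟨ [1+k]*nC[1+k]≡[n∸k]*nCk N f′ ⟩
    (N ∸ f′) * c f′            ≡⟨ cong (_* c f′) (trans (N∸i≡ ≤-refl) (cong (_+ f * m) (n∸n≡0 f′))) ⟩
    f * m * c f′               ≡⟨ *-assoc f m (c f′) ⟩
    f * (m * c f′)             ∎
    where open ≡-Reasoning

  T≡0-low : ∀ {x i} → x < f → i ≤ f′ → T x i ≡ 0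
  T≡0-low {x} {i} x<f i≤f′ = T≡0-below x i $ begin
    suc x * m         ≤⟨ *-monoˡ-≤ m x<f ⟩
    f * m             ≤⟨ m≤n+m (f * m) (f′ ∸ i) ⟩
    f′ ∸ i + f * m    ≡⟨ N∸i≡ i≤f′ ⟨
    N ∸ i             ∎
    where open ≤-Reasoning

  T≡0-high : ∀ {x} → suc f ≤ x → T x f′ ≡ 0
  T≡0-high {x} 1+f≤x = T≡0-above x f′ $ begin
    N ∸ f′ + m        ≡⟨ cong (_+ m) (trans (N∸i≡ ≤-refl) (cong (_+ f * m) (n∸n≡0 f′))) ⟩
    f * m + m         ≡⟨ +-comm (f * m) m ⟩
    suc f * m         ≤⟨ *-monoˡ-≤ m 1+f≤x ⟩
    x * m             ∎
    where open ≤-Reasoning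

  T-≤-ramp : ∀ {i} → i ≤ f′ → T f i ≤ m ∸ (f′ ∸ i)
  T-≤-ramp {i} i≤f′ = T-≤-below f i (m ∸ (f′ ∸ i)) $ begin
    m + f * m                           ≤⟨ +-monoˡ-≤ (f * m) (m≤n+m∸n m (f′ ∸ i)) ⟩
    f′ ∸ i + (m ∸ (f′ ∸ i)) + f * m     ≡⟨ +-CS.xy∙z≈xz∙y (f′ ∸ i) (m ∸ (f′ ∸ i)) (f * m) ⟩
    f′ ∸ i + f * m + (m ∸ (f′ ∸ i))     ≡⟨ cong (_+ (m ∸ (f′ ∸ i))) (N∸i≡ i≤f′) ⟨
    N ∸ i + (m ∸ (f′ ∸ i))              ∎
    where open ≤-Reasoning

  T-≤-linear : ∀ {i} → i ≤ f′ → T (suc f) i ≤ f′ ∸ i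
  T-≤-linear {i} i≤f′ = T-≤-above (suc f) i (f′ ∸ i) $ begin
    N ∸ i + m                   ≡⟨ cong (_+ m) (N∸i≡ i≤f′) ⟩
    f′ ∸ i + f * m + m          ≡⟨ regroup (f′ ∸ i) f m ⟩
    suc f * m + (f′ ∸ i)        ∎
    where
    open ≤-Reasoning
    regroup : ∀ j f m → j + f * m + m ≡ suc f * m + j
    regroup = solve-∀

  f′≤f*m : f′ ≤ f * m
  f′≤f*m = ≤-trans (n≤1+n f′) (m≤m*n f m)

  N≤c-f′ : N ≤ c f′
  N≤c-f′ = ≤-trans (≤-reflexive (sym (nC1≡n N)))
                   (C-mono-≤ N (s≤s z≤n) (≤-trans (+-monoʳ-≤ f′ f′≤f*m) (n≤1+n N)))

  v≤c-f′ : v ≤ c f′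
  v≤c-f′ = ≤-trans (+-mono-≤ (s≤s z≤n) (m≤n*m m f)) N≤c-f′

  mult⋆*≤ : suc v * mult⋆ ≤ s′ + v
  mult⋆*≤ = ≤-trans (≤-reflexive (*-comm (suc v) mult⋆)) (⌈/suc⌉*≤ s′ v)

  twice-mult⋆≤ : 2 * mult⋆ ≤ c f′
  twice-mult⋆≤ = *-cancelˡ-≤ (suc v) $ begin
    suc v * (2 * mult⋆)     ≡⟨ *-CS.x∙yz≈y∙xz (suc v) 2 mult⋆ ⟩
    2 * (suc v * mult⋆)     ≤⟨ *-monoʳ-≤ 2 (≤-trans mult⋆*≤ (+-monoˡ-≤ v s′≤c-f′)) ⟩
    2 * (c f′ + v)          ≡⟨ *-distribˡ-+ 2 (c f′) v ⟩
    2 * c f′ + 2 * v        ≤⟨ +-monoʳ-≤ (2 * c f′) (≤-trans (*-monoˡ-≤ v (s≤s (s≤s (z≤n {k})))) (*-monoʳ-≤ m v≤c-f′)) ⟩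
    2 * c f′ + m * c f′     ≡⟨ *-distribʳ-+ (c f′) 2 m ⟨
    suc v * c f′            ∎
    where open ≤-Reasoning


  μ-L⋆-f′ : μ L⋆ f′ ≡ 2
  μ-L⋆-f′ = trans (μ-L⋆ f′) (trans (cong₃ (λ a b e → 2 * a + k * b + e) (δ-refl f′) (δ-≢ (1+n≢n {f′})) (δ-≢ (f′≢2+f′ ∘′ sym)))
                                   (cong (λ z → 2 + z + 0) (*-zeroʳ k)))
    where f′≢2+f′ = <⇒≢ (m<n⇒m<1+n (n<1+n f′))

  μ-L⋆-f : μ L⋆ f ≡ k
  μ-L⋆-f = trans (μ-L⋆ f) (trans (cong₃ (λ a b e → 2 * a + k * b + e) (δ-≢ (<⇒≢ (n<1+n f′))) (δ-refl f) (δ-≢ (1+n≢n {f})))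
                                 (trans (+-identityʳ (k * 1)) (*-identityʳ k)))

  μ-L⋆-1+f : μ L⋆ (suc f) ≡ 1
  μ-L⋆-1+f = trans (μ-L⋆ (suc f)) (trans (cong₃ (λ a b e → 2 * a + k * b + e)
                                                 (δ-≢ (<⇒≢ (m<n⇒m<1+n (n<1+n f′)))) (δ-≢ (<⇒≢ (n<1+n f))) (δ-refl (suc f)))
                                          (cong (_+ 1) (*-zeroʳ k)))

  μ-L⋆-≡0 : ∀ {x} → f′ ≢ x → f ≢ x → suc f ≢ x → μ L⋆ x ≡ 0
  μ-L⋆-≡0 {x} f′≢x f≢x 1+f≢x = trans (μ-L⋆ x) (trans (cong₃ (λ a b e → 2 * a + k * b + e) (δ-≢ f′≢x) (δ-≢ f≢x) (δ-≢ 1+f≢x))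
                                                         (cong (_+ 0) (*-zeroʳ k)))

  μ-Lf′-≢ : ∀ {x} → f′ ≢ x → μ (Lshape N v f′) x ≡ T x f′
  μ-Lf′-≢ {x} f′≢x = trans (μ-Lshape f′ x) (cong (_+ T x f′) (δ-≢ f′≢x))

  count-beyond-f′ : ∀ {x} → f′ < x → count x ≡ ∑[ i < f′ ] (c i * T x i) + mult′ * T x f′ + mult⋆ * μ L⋆ x
  count-beyond-f′ {x} f′<x = cong₂ (λ a b → a + mult′ * b + mult⋆ * μ L⋆ x) (prefix-above f′ x (<⇒≤ f′<x)) (μ-Lf′-≢ (<⇒≢ f′<x))

  count-below : ∀ {x} → x < f′ → count x ≡ c x
  count-below {x} x<f′ = begin
    prefix f′ x + mult′ * μ (Lshape N v f′) x + mult⋆ * μ L⋆ x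
      ≡⟨ cong₃ (λ a b e → a + mult′ * b + mult⋆ * e) (prefix-below f′ x x<f′ (T≡0-low x<f ∘′ <⇒≤)) (μ-Lf′-≢ (<⇒≢ x<f′ ∘′ sym))
               (μ-L⋆-≡0 (<⇒≢ x<f′ ∘′ sym) (<⇒≢ x<f ∘′ sym) (<⇒≢ (m<n⇒m<1+n x<f) ∘′ sym)) ⟩
    c x + mult′ * T x f′ + mult⋆ * 0    ≡⟨ cong (λ t → c x + mult′ * t + mult⋆ * 0) (T≡0-low x<f ≤-refl) ⟩
    c x + mult′ * 0 + mult⋆ * 0         ≡⟨ vanish (c x) mult′ mult⋆ ⟩
    c x                                 ∎
    where
    open ≡-Reasoning
    x<f = m<n⇒m<1+n x<f′
    vanish : ∀ a b e → a + b * 0 + e * 0 ≡ a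
    vanish = solve-∀

  count-at-f′ : count f′ ≡ c f′
  count-at-f′ = begin
    prefix f′ f′ + mult′ * μ (Lshape N v f′) f′ + mult⋆ * μ L⋆ f′
      ≡⟨ cong₃ (λ a b e → a + mult′ * b + mult⋆ * e) (prefix-f′≡0) (μ-Lshape f′ f′) μ-L⋆-f′ ⟩
    0 + mult′ * (δ f′ f′ + T f′ f′) + mult⋆ * 2
      ≡⟨ cong₂ (λ a t → mult′ * (a + t) + mult⋆ * 2) (δ-refl f′) (T≡0-low (n<1+n f′) ≤-refl) ⟩
    mult′ * 1 + mult⋆ * 2               ≡⟨ cong₂ _+_ (*-identityʳ mult′) (*-comm mult⋆ 2) ⟩
    mult′ + 2 * mult⋆                   ≡⟨ m∸n+n≡m twice-mult⋆≤ ⟩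
    c f′                                ∎
    where
    open ≡-Reasoning
    prefix-f′≡0 : prefix f′ f′ ≡ 0
    prefix-f′≡0 = trans (prefix-above f′ f′ ≤-refl)
      (∑-zero f′ (λ {i} i<f′ → trans (cong (c i *_) (T≡0-low (n<1+n f′) (<⇒≤ i<f′))) (*-zeroʳ (c i))))

  count-at-f : count f ≤ c f
  count-at-f = begin
    count f                                                  ≡⟨ count-beyond-f′ (n<1+n f′) ⟩
    ∑[ i < f′ ] (c i * T f i) + mult′ * T f f′ + mult⋆ * μ L⋆ f
      ≤⟨ +-mono-≤ (+-mono-≤ (∑-T-≤ f′ f (λ i → m ∸ (f′ ∸ i)) (T-≤-ramp ∘′ <⇒≤)) (*-monoʳ-≤ mult′ (T-≤ f f′)))
                  (≤-reflexive (cong (mult⋆ *_) μ-L⋆-f)) ⟩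
    s′ + mult′ * m + mult⋆ * k                               ≤⟨ +-monoˡ-≤ _ (+-monoˡ-≤ (mult′ * m) (≤⌈/suc⌉* s′ v)) ⟩
    mult⋆ * suc v + mult′ * m + mult⋆ * k                    ≡⟨ regroup mult⋆ mult′ k ⟩
    m * (mult′ + 2 * mult⋆)                                  ≡⟨ cong (m *_) (m∸n+n≡m twice-mult⋆≤) ⟩
    m * c f′                                                 ≡⟨ c-f≡m*c-f′ ⟨
    c f                                                      ∎
    where
    open ≤-Reasoning
    regroup : ∀ a b k → a * suc (suc (suc (suc k))) + b * suc (suc k) + a * k ≡ suc (suc k) * (b + 2 * a)
    regroup = solve-∀

  count-at-1+f-≤ : count (suc f) ≤ linear c f′ 0 + mult⋆
  count-at-1+f-≤ = begin
    count (suc f)                                                         ≡⟨ count-beyond-f′ f′<1+f ⟩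
    ∑[ i < f′ ] (c i * T (suc f) i) + mult′ * T (suc f) f′ + mult⋆ * μ L⋆ (suc f)
      ≡⟨ cong₂ (λ t e → ∑[ i < f′ ] (c i * T (suc f) i) + mult′ * t + mult⋆ * e) (T≡0-high ≤-refl) μ-L⋆-1+f ⟩
    ∑[ i < f′ ] (c i * T (suc f) i) + mult′ * 0 + mult⋆ * 1              ≡⟨ simplify (∑[ i < f′ ] (c i * T (suc f) i)) mult′ mult⋆ ⟩
    ∑[ i < f′ ] (c i * T (suc f) i) + mult⋆                               ≤⟨ +-monoˡ-≤ mult⋆ (∑-T-≤ f′ (suc f) (f′ ∸_) (T-≤-linear ∘′ <⇒≤)) ⟩
    linear c f′ 0 + mult⋆                                                 ∎
    where
    open ≤-Reasoning
    f′<1+f = m<n⇒m<1+n (n<1+n f′)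
    simplify : ∀ a b e → a + b * 0 + e * 1 ≡ a + e
    simplify = solve-∀

  c-f≤c-1+f : c f ≤[ suc f ÷ P ] c (suc f)
  c-f≤c-1+f = subst (λ p → c f ≤[ suc f ÷ p ] c (suc f)) N∸f≡P (c-ratio f)

  c-f′≤c-f : c f′ ≤[ 1 ÷ m ] c f
  c-f′≤c-f = ratio (≤-reflexive (trans (sym c-f≡m*c-f′) (sym (*-identityˡ (c f)))))

  mult⋆≤ : mult⋆ ≤[ 1 * (m′ * α + γ) ÷ suc v * γ ] c f′
  mult⋆≤ = ≤[÷]-compose mult⋆≤s′+c-f′ (≤[÷]-+ (ramp-geometric m′ geometric) (≤[÷]-refl γ (c f′)))
    where
    mult⋆≤s′+c-f′ : mult⋆ ≤[ 1 ÷ suc v ] s′ + c f′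
    mult⋆≤s′+c-f′ = ratio (≤-trans mult⋆*≤ (≤-trans (+-monoʳ-≤ s′ v≤c-f′) (≤-reflexive (sym (*-identityˡ _)))))

  linear+mult⋆≤ : linear c f′ 0 + mult⋆ ≤[ ((suc v * (2 * α) + 1 * (m′ * α + γ)) * 1) * suc f ÷ suc v * γ * m * P ] c (suc f)
  linear+mult⋆≤ =
    ≤[÷]-compose (≤[÷]-compose (≤[÷]-+ (≤[÷]-expand (suc v) (linear-geometric α≤γ 0 geometric)) mult⋆≤) c-f′≤c-f)
                 c-f≤c-1+f

  count-at-1+f : count (suc f) ≤ c (suc f)
  count-at-1+f = ≤-trans count-at-1+f-≤ (≤[÷]⇒≤ (divisible-inequality g k) linear+mult⋆≤)

  count-above : ∀ {x} → suc (suc f) ≤ x → count x ≤ c x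
  count-above {x} 2+f≤x = begin
    count x                                                  ≡⟨ count-beyond-f′ f′<x ⟩
    ∑[ i < f′ ] (c i * T x i) + mult′ * T x f′ + mult⋆ * μ L⋆ x
      ≡⟨ cong₂ (λ t e → ∑[ i < f′ ] (c i * T x i) + mult′ * t + mult⋆ * e) (T≡0-high (<⇒≤ 2+f≤x))
               (μ-L⋆-≡0 (<⇒≢ f′<x) (<⇒≢ f<x) (<⇒≢ 2+f≤x)) ⟩
    ∑[ i < f′ ] (c i * T x i) + mult′ * 0 + mult⋆ * 0         ≡⟨ vanish (∑[ i < f′ ] (c i * T x i)) mult′ mult⋆ ⟩
    ∑[ i < f′ ] (c i * T x i)                                 ≤⟨ tail-≤ (s≤s z≤n) room m∑≤ (<⇒≤ f<x) ⟩
    c x                                                       ∎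
    where
    open ≤-Reasoning
    f<x = <-trans (n<1+n f) 2+f≤x
    f′<x = <-trans (n<1+n f′) f<x
    vanish : ∀ a b e → a + b * 0 + e * 0 ≡ a
    vanish = solve-∀
    room : f + f ≤ N
    room = begin
      f + f       ≡⟨ cong (f +_) (+-identityʳ f) ⟨
      2 * f       ≤⟨ *-monoˡ-≤ f (s≤s (s≤s (z≤n {k}))) ⟩
      m * f       ≡⟨ *-comm m f ⟩
      f * m       ≤⟨ m≤n+m (f * m) f′ ⟩
      N           ∎
    m∑≤ : m * ∑< f′ c ≤ c f
    m∑≤ = ≤-trans (*-monoʳ-≤ m (≤[÷]⇒≤ α≤γ (∑-geometric geometric))) (≤-reflexive (sym c-f≡m*c-f′))

divisible-count-≤ : ∀ g k x → Divisible.count g k x ≤ Divisible.N g k C x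
divisible-count-≤ g k x with <-cmp x (suc g)
... | tri< x<f′ _ _ = ≤-reflexive (Divisible.count-below g k x<f′)
... | tri≈ _ refl _ = ≤-reflexive (Divisible.count-at-f′ g k)
... | tri> _ _ f′<x with m≤n⇒m<n∨m≡n f′<x
...   | inj₂ refl = Divisible.count-at-f g k
...   | inj₁ f<x with m≤n⇒m<n∨m≡n f<x
...     | inj₂ refl   = Divisible.count-at-1+f g k
...     | inj₁ 1+f<x  = Divisible.count-above g k 1+f<x

-- Imported only here: the prefix +_ of ℤ would make sections such as (x +_) on ℕ ambiguous.
open import Data.Integer.Base as ℤ using (ℤ; +_; -[1+_]; 0ℤ; _-_; -_; _⊖_)
import Data.Integer.Properties as ℤ
open import Data.Integer.Tactic.RingSolver renaming (solve-∀ to ℤ-solve-∀)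

sumℤ-++ : ∀ xs ys → sumℤ (xs ++ ys) ≡ sumℤ xs ℤ.+ sumℤ ys
sumℤ-++ []       ys = sym (ℤ.+-identityˡ (sumℤ ys))
sumℤ-++ (x ∷ xs) ys = trans (cong (λ y → x ℤ.+ y) (sumℤ-++ xs ys)) (sym (ℤ.+-assoc x (sumℤ xs) (sumℤ ys)))

sumℤ-upTo-suc : ∀ (h : ℕ → ℤ) n → sumℤ (map h (upTo (suc n))) ≡ sumℤ (map h (upTo n)) ℤ.+ h n
sumℤ-upTo-suc h n = begin
  sumℤ (map h (upTo (suc n)))              ≡⟨ cong (sumℤ ∘ map h) (upTo-∷ʳ n) ⟨
  sumℤ (map h (upTo n ∷ʳ n))               ≡⟨ cong sumℤ (map-++ h (upTo n) (n ∷ [])) ⟩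
  sumℤ (map h (upTo n) ++ (h n ∷ []))      ≡⟨ sumℤ-++ (map h (upTo n)) (h n ∷ []) ⟩
  sumℤ (map h (upTo n)) ℤ.+ (h n ℤ.+ 0ℤ)   ≡⟨ cong (λ y → sumℤ (map h (upTo n)) ℤ.+ y) (ℤ.+-identityʳ (h n)) ⟩
  sumℤ (map h (upTo n)) ℤ.+ h n            ∎
  where open ≡-Reasoning

sumℤ-zero : ∀ (h : ℕ → ℤ) n → (∀ {j} → j ℕ.< n → h j ≡ 0ℤ) → sumℤ (map h (upTo n)) ≡ 0ℤ
sumℤ-zero h zero    _   = refl
sumℤ-zero h (suc n) h≡0 = trans (sumℤ-upTo-suc h n)
  (cong₂ ℤ._+_ (sumℤ-zero h n (λ j<n → h≡0 (ℕ.m<n⇒m<1+n j<n))) (h≡0 ℕ.≤-refl))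

+suc : ∀ n → + suc n ≡ + n ℤ.+ + 1
+suc n = trans (cong +_ (ℕ.+-comm 1 n)) (ℤ.pos-+ n 1)

binomZ-negative : ∀ N {D j} → j ℕ.< D → binomZ N (+ 0 - + D ℤ.+ + j) ≡ 0ℤ
binomZ-negative N {suc D} {j} (s≤s j≤D) = cong (binomZ N) $ begin
  -[1+ D ] ℤ.+ + j     ≡⟨ ℤ.+-comm -[1+ D ] (+ j) ⟩
  j ⊖ suc D            ≡⟨ ℤ.⊖-< (s≤s j≤D) ⟩
  - + (suc D ℕ.∸ j)    ≡⟨ cong (λ n → - + n) (ℕ.+-∸-assoc 1 j≤D) ⟩
  -[1+ D ℕ.∸ j ]       ∎
  where open ≡-Reasoning

sumℤ-ramp : ∀ N a D → sumℤ (map (λ j → (+ j ℤ.+ + 1) ℤ.* binomZ N (+ a - + D ℤ.+ + j)) (upTo D)) ≡ + ramp (N C_) a D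
sumℤ-ramp N a       zero    = sym (cong +_ (ramp-zero (N C_) a))
sumℤ-ramp N zero    (suc D) = sumℤ-zero _ (suc D) λ {j} j<D →
  trans (cong ((+ j ℤ.+ + 1) ℤ.*_) (binomZ-negative N j<D)) (ℤ.*-zeroʳ (+ j ℤ.+ + 1))
sumℤ-ramp N (suc a) (suc D) = begin
  sumℤ (map h (upTo (suc D)))                ≡⟨ sumℤ-upTo-suc h D ⟩
  sumℤ (map h (upTo D)) ℤ.+ h D               ≡⟨ cong₂ ℤ._+_ (trans (cong sumℤ (map-cong shift (upTo D))) (sumℤ-ramp N a D)) last ⟩
  + ramp (N C_) a D ℤ.+ + ((N C a) ℕ.* suc D)   ≡⟨ ℤ.pos-+ (ramp (N C_) a D) ((N C a) ℕ.* suc D) ⟨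
  + (ramp (N C_) a D ℕ.+ (N C a) ℕ.* suc D)     ≡⟨ cong +_ (ramp-suc (N C_) a D) ⟨
  + ramp (N C_) (suc a) (suc D)               ∎
  where
  open ≡-Reasoning
  h : ℕ → ℤ
  h j = (+ j ℤ.+ + 1) ℤ.* binomZ N (+ suc a - + suc D ℤ.+ + j)
  shift : ∀ j → h j ≡ (+ j ℤ.+ + 1) ℤ.* binomZ N (+ a - + D ℤ.+ + j)
  shift j = cong (λ z → (+ j ℤ.+ + 1) ℤ.* binomZ N z)
    (trans (cong₂ (λ x y → x - y ℤ.+ + j) (+suc a) (+suc D)) (cancel (+ a) (+ D) (+ j)))
    where
    cancel : ∀ a D j → a ℤ.+ + 1 - (D ℤ.+ + 1) ℤ.+ j ≡ a - D ℤ.+ j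
    cancel = ℤ-solve-∀
  last : h D ≡ + ((N C a) ℕ.* suc D)
  last = begin
    (+ D ℤ.+ + 1) ℤ.* binomZ N (+ suc a - + suc D ℤ.+ + D)   ≡⟨ cong₂ (λ x z → x ℤ.* binomZ N z) (sym (+suc D))
                                                                       (trans (cong₂ (λ x y → x - y ℤ.+ + D) (+suc a) (+suc D)) (cancel (+ a) (+ D))) ⟩
    + suc D ℤ.* + (N C a)                                    ≡⟨ ℤ.pos-* (suc D) (N C a) ⟨
    + (suc D ℕ.* (N C a))                                      ≡⟨ cong +_ (ℕ.*-comm (suc D) (N C a)) ⟩
    + ((N C a) ℕ.* suc D)                                      ∎
    where
    cancel : ∀ a D → a ℤ.+ + 1 - (D ℤ.+ + 1) ℤ.+ D ≡ a
    cancel = ℤ-solve-∀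

rangeSum-ramp : ∀ N a D {w : ℤ → ℤ} {lo hi : ℤ} → lo ≡ + a - + D → hi ≡ + a - + 1 →
  (∀ j → w (lo ℤ.+ + j) ≡ (+ j ℤ.+ + 1) ℤ.* binomZ N (lo ℤ.+ + j)) → rangeSum lo hi w ≡ + ramp (N C_) a D
rangeSum-ramp N a D {w} refl refl hw = begin
  sumℤ (map (λ j → w (+ a - + D ℤ.+ + j)) (upTo (clamp ((+ a - + 1 ℤ.+ + 1) - (+ a - + D)))))
    ≡⟨ cong (λ n → sumℤ (map (λ j → w (+ a - + D ℤ.+ + j)) (upTo (clamp n)))) (length≡ (+ a) (+ D)) ⟩
  sumℤ (map (λ j → w (+ a - + D ℤ.+ + j)) (upTo D))
    ≡⟨ cong sumℤ (map-cong hw (upTo D)) ⟩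
  sumℤ (map (λ j → (+ j ℤ.+ + 1) ℤ.* binomZ N (+ a - + D ℤ.+ + j)) (upTo D))
    ≡⟨ sumℤ-ramp N a D ⟩
  + ramp (N C_) a D ∎
  where
  open ≡-Reasoning
  length≡ : ∀ a D → a - + 1 ℤ.+ + 1 - (a - D) ≡ D
  length≡ = ℤ-solve-∀

Admissible : ℕ → ℕ → VType → Set
Admissible N v 𝓜 = All (λ p → length (proj₂ p) ≡ v) 𝓜
                 × All (λ p → 0ℤ ℤ.≤ proj₁ p) 𝓜
                 × ((x : ℕ) → x ≤ N → total 𝓜 x ℤ.≤ + (N C x))

total-++ : ∀ 𝓜 𝓝 x → total (𝓜 ++ 𝓝) x ≡ total 𝓜 x ℤ.+ total 𝓝 x
total-++ 𝓜 𝓝 x = trans (cong sumℤ (map-++ _ 𝓜 𝓝)) (sumℤ-++ (map _ 𝓜) (map _ 𝓝))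

full-copies : ℕ → ℕ → ℕ → VType
full-copies N v a = map (λ i → (+ (N C i) , Lshape N v i)) (upTo a)

total-full-copies : ∀ N v a x → total (full-copies N v a) x ≡ + ∑[ i < a ] ((N C i) ℕ.* μ (Lshape N v i) x)
total-full-copies N v zero    x = refl
total-full-copies N v (suc a) x = begin
  total (full-copies N v (suc a)) x              ≡⟨ cong (λ is → total (map ψ is) x) (upTo-∷ʳ a) ⟨
  total (map ψ (upTo a ∷ʳ a)) x                  ≡⟨ cong (λ 𝓜 → total 𝓜 x) (map-++ ψ (upTo a) (a ∷ [])) ⟩
  total (full-copies N v a ++ (ψ a ∷ [])) x      ≡⟨ total-++ (full-copies N v a) (ψ a ∷ []) x ⟩
  total (full-copies N v a) x ℤ.+ (+ (N C a) ℤ.* + μ (Lshape N v a) x ℤ.+ 0ℤ)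
    ≡⟨ cong₂ (λ s t → s ℤ.+ (t ℤ.+ 0ℤ)) (total-full-copies N v a x) (sym (ℤ.pos-* (N C a) (μ (Lshape N v a) x))) ⟩
  + ∑< a term ℤ.+ (+ term a ℤ.+ 0ℤ)               ≡⟨ cong (λ t → + ∑< a term ℤ.+ t) (ℤ.+-identityʳ (+ term a)) ⟩
  + ∑< a term ℤ.+ + term a                        ≡⟨ ℤ.pos-+ (∑< a term) (term a) ⟨
  + ∑< (suc a) term                               ∎
  where
  open ≡-Reasoning
  ψ = λ i → (+ (N C i) , Lshape N v i)
  term = λ i → (N C i) ℕ.* μ (Lshape N v i) x

total-two-more : ∀ N v a b M e M′ x →
  total (full-copies N v a ++ ((+ b , M) ∷ (+ e , M′) ∷ [])) x
    ≡ + (∑[ i < a ] ((N C i) ℕ.* μ (Lshape N v i) x) ℕ.+ b ℕ.* μ M x ℕ.+ e ℕ.* μ M′ x)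
total-two-more N v a b M e M′ x = begin
  total (full-copies N v a ++ ((+ b , M) ∷ (+ e , M′) ∷ [])) x
    ≡⟨ total-++ (full-copies N v a) _ x ⟩
  total (full-copies N v a) x ℤ.+ (+ b ℤ.* + μ M x ℤ.+ (+ e ℤ.* + μ M′ x ℤ.+ 0ℤ))
    ≡⟨ cong₃ (λ s t u → s ℤ.+ (t ℤ.+ (u ℤ.+ 0ℤ))) (total-full-copies N v a x) (sym (ℤ.pos-* b (μ M x))) (sym (ℤ.pos-* e (μ M′ x))) ⟩
  + S ℤ.+ (+ B ℤ.+ (+ E ℤ.+ 0ℤ))
    ≡⟨ collect (+ S) (+ B) (+ E) ⟩
  (+ S ℤ.+ + B) ℤ.+ + E
    ≡⟨ trans (cong (ℤ._+ + E) (sym (ℤ.pos-+ S B))) (sym (ℤ.pos-+ (S ℕ.+ B) E)) ⟩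
  + (S ℕ.+ B ℕ.+ E) ∎
  where
  open ≡-Reasoning
  S = ∑[ i < a ] ((N C i) ℕ.* μ (Lshape N v i) x)
  B = b ℕ.* μ M x
  E = e ℕ.* μ M′ x
  collect : ∀ s t u → s ℤ.+ (t ℤ.+ (u ℤ.+ 0ℤ)) ≡ s ℤ.+ t ℤ.+ u
  collect = ℤ-solve-∀

𝓛-nondivisible : ∀ N v → ¬ v ∣ suc N → let f = fOf N v in
  𝓛 N v ≡ full-copies N v (f ∸ 1) ++ ((+ (N C (f ∸ 1)) , Lshape N v (f ∸ 1))
                                     ∷ (floorDiv (+ (N C f) - sOf N v) (clamp (dOf N v)) , Lshape N v f) ∷ [])
𝓛-nondivisible N v v∤ with v ∣? suc N
... | yes v∣ = ⊥-elim (v∤ v∣)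
... | no  _  = refl

𝓛-divisible : ∀ N v → v ∣ suc N → let f = fOf N v ; c = ceilDiv (s'Of N v) (suc v) in
  𝓛 N v ≡ full-copies N v (f ∸ 1) ++ ((+ (N C (f ∸ 1)) - + 2 ℤ.* c , Lshape N v (f ∸ 1)) ∷ (c , Lstar N v) ∷ [])
𝓛-divisible N v v∣ with v ∣? suc N
... | yes _  = refl
... | no  v∤ = ⊥-elim (v∤ v∣)

sOf≡ramp : ∀ N v f D → fOf N v ≡ f → dOf N v ≡ + suc (suc D) → sOf N v ≡ + ramp (N C_) f D
sOf≡ramp N v f D refl d≡ = rangeSum-ramp N f D {λ i → (dOf N v - + f - + 1 ℤ.+ i) ℤ.* binomZ N i} (lo≡ d≡) refl
  (λ j → cong (ℤ._* binomZ N (+ f - dOf N v ℤ.+ + 2 ℤ.+ + j)) (weight (dOf N v) (+ f) (+ j)))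
  where
  lo≡ : ∀ {d} → d ≡ + suc (suc D) → + f - d ℤ.+ + 2 ≡ + f - + D
  lo≡ refl = trans (cong (λ z → + f - z ℤ.+ + 2) (trans (+suc (suc D)) (cong (ℤ._+ + 1) (+suc D)))) (cancel (+ f) (+ D))
    where
    cancel : ∀ f D → f - (D ℤ.+ + 1 ℤ.+ + 1) ℤ.+ + 2 ≡ f - D
    cancel = ℤ-solve-∀
  weight : ∀ d f j → d - f - + 1 ℤ.+ (f - d ℤ.+ + 2 ℤ.+ j) ≡ j ℤ.+ + 1
  weight = ℤ-solve-∀

s′Of≡ramp : ∀ N m′ f′ → let v = suc (suc m′) in fOf N v ≡ suc f′ → s'Of N v ≡ + ramp (N C_) f′ m′
s′Of≡ramp N m′ f′ f≡ = rangeSum-ramp N f′ m′ {λ i → (+ v - + fOf N v ℤ.+ i) ℤ.* binomZ N i}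
  (trans (cong (λ F → + F - + v ℤ.+ + 1) f≡)
         (trans (cong₂ (λ a b → a - b ℤ.+ + 1) (+suc f′) (trans (+suc (suc m′)) (cong (ℤ._+ + 1) (+suc m′))))
                (lo≡ (+ f′) (+ m′))))
  (trans (cong (λ F → + F - + 2) f≡) (trans (cong (_- + 2) (+suc f′)) (hi≡ (+ f′))))
  (λ j → cong (ℤ._* binomZ N (+ fOf N v - + v ℤ.+ + 1 ℤ.+ + j)) (weight (+ v) (+ fOf N v) (+ j)))
  where
  v = suc (suc m′)
  lo≡ : ∀ f′ m′ → (f′ ℤ.+ + 1) - (m′ ℤ.+ + 1 ℤ.+ + 1) ℤ.+ + 1 ≡ f′ - m′
  lo≡ = ℤ-solve-∀
  hi≡ : ∀ f′ → (f′ ℤ.+ + 1) - + 2 ≡ f′ - + 1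
  hi≡ = ℤ-solve-∀
  weight : ∀ v f j → v - f ℤ.+ (f - v ℤ.+ + 1 ℤ.+ j) ≡ j ℤ.+ + 1
  weight = ℤ-solve-∀

ceilDiv≡ : ∀ s M → ceilDiv (+ s) (suc M) ≡ + ⌈ s /suc M ⌉
ceilDiv≡ zero    M = refl
ceilDiv≡ (suc s) M = refl

+-∸-pos : ∀ {a b} → b ≤ a → + a - + b ≡ + (a ∸ b)
+-∸-pos {a} {b} b≤a = trans (ℤ.m-n≡m⊖n a b) (ℤ.⊖-≥ b≤a)

+[a+b]-b : ∀ a b → + (a ℕ.+ b) - + b ≡ + a
+[a+b]-b a b = trans (cong (_- + b) (ℤ.pos-+ a b)) (cancel (+ a) (+ b))
  where
  cancel : ∀ a b → a ℤ.+ b - b ≡ a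
  cancel = ℤ-solve-∀

module _ (f′ r D : ℕ) (1≤m′ : 1 ≤ r ℕ.+ D) where

  open NonDivisible f′ r D

  private
    v = suc m

    1+r<v : suc r < v
    1+r<v = s≤s (s≤s (ℕ.m≤m+n r D))

    fOf≡f : fOf N v ≡ f
    fOf≡f = trans (+-distrib-/-∣ʳ (suc r) {f ℕ.* v} {v} (n∣m*n f)) (cong₂ ℕ._+_ (m<n⇒m/n≡0 1+r<v) (m*n/n≡m f v))

    v∤1+N : ¬ v ∣ suc N
    v∤1+N v∣1+N = ℕ.<⇒≱ 1+r<v (∣⇒≤ (∣m+n∣m⇒∣n (subst (v ∣_) (ℕ.+-comm (suc r) (f ℕ.* v)) v∣1+N) (n∣m*n f)))

    dOf≡d : dOf N v ≡ + d
    dOf≡d = trans (cong (λ F → + (suc F ℕ.* v) - + N) fOf≡f)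
                  (trans (cong (λ n → + n - + N) (regroup r D f)) (+[a+b]-b d N))
      where
      regroup : ∀ r D f → suc f ℕ.* suc (suc (r ℕ.+ D)) ≡ suc (suc D) ℕ.+ (r ℕ.+ f ℕ.* suc (suc (r ℕ.+ D)))
      regroup = solve-∀

    mult≡ : floorDiv (+ (N C fOf N v) - sOf N v) (clamp (dOf N v)) ≡ + mult
    mult≡ = begin
      floorDiv (+ (N C fOf N v) - sOf N v) (clamp (dOf N v))  ≡⟨ cong₃ (λ F S δ → floorDiv (+ (N C F) - S) (clamp δ))
                                                                        fOf≡f (sOf≡ramp N v f D fOf≡f dOf≡d) dOf≡d ⟩
      floorDiv (+ (N C f) - + s) d                           ≡⟨ cong (λ z → floorDiv z d) (+-∸-pos s≤cf) ⟩
      + mult                                                 ∎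
      where
      open ≡-Reasoning

    𝓛≡ : 𝓛 N v ≡ full-copies N v f′ ++ ((+ c f′ , Lshape N v f′) ∷ (+ mult , Lshape N v f) ∷ [])
    𝓛≡ = trans (𝓛-nondivisible N v v∤1+N)
               (cong₂ (λ F μ′ → full-copies N v (F ∸ 1) ++ ((+ (N C (F ∸ 1)) , Lshape N v (F ∸ 1)) ∷ (μ′ , Lshape N v F) ∷ []))
                      fOf≡f mult≡)

  nondivisible-admissible : Admissible N v (𝓛 N v)
  nondivisible-admissible = subst (Admissible N v) (sym 𝓛≡)
    ( ++⁺ (map⁺ (applyUpTo⁺₂ (λ i → i) f′ (λ i → length-Lshape i))) (length-Lshape f′ ∷ length-Lshape f ∷ [])
    , ++⁺ (map⁺ (applyUpTo⁺₂ (λ i → i) f′ (λ _ → ℤ.+≤+ z≤n))) (ℤ.+≤+ z≤n ∷ ℤ.+≤+ z≤n ∷ [])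
    , λ x _ → subst (ℤ._≤ + (N C x)) (sym (total-two-more N v f′ (c f′) (Lshape N v f′) mult (Lshape N v f) x))
                    (ℤ.+≤+ (nondivisible-count-≤ f′ r D 1≤m′ x)) )

module _ (g k : ℕ) where

  open Divisible g k

  private
    1+N≡f*v : suc N ≡ f ℕ.* v
    1+N≡f*v = regroup g k
      where
      regroup : ∀ g k → suc (suc g ℕ.+ suc (suc g) ℕ.* suc (suc k)) ≡ suc (suc g) ℕ.* suc (suc (suc k))
      regroup = solve-∀

    fOf≡f : fOf N v ≡ f
    fOf≡f = trans (cong (_/ v) 1+N≡f*v) (m*n/n≡m f v)

    v∣1+N : v ∣ suc N
    v∣1+N = subst (v ∣_) (sym 1+N≡f*v) (n∣m*n f)

    mult⋆≡ : ceilDiv (s'Of N v) (suc v) ≡ + mult⋆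
    mult⋆≡ = trans (cong (λ S → ceilDiv S (suc v)) (s′Of≡ramp N m′ f′ fOf≡f)) (ceilDiv≡ s′ v)

    mult′≡ : + (N C f′) - + 2 ℤ.* + mult⋆ ≡ + mult′
    mult′≡ = trans (cong (λ z → + (N C f′) - z) (sym (ℤ.pos-* 2 mult⋆))) (+-∸-pos twice-mult⋆≤)

    𝓛≡ : 𝓛 N v ≡ full-copies N v f′ ++ ((+ mult′ , Lshape N v f′) ∷ (+ mult⋆ , L⋆) ∷ [])
    𝓛≡ = trans (𝓛-divisible N v v∣1+N) (trans
           (cong₂ (λ F μ⋆ → full-copies N v (F ∸ 1) ++ ((+ (N C (F ∸ 1)) - + 2 ℤ.* μ⋆ , Lshape N v (F ∸ 1))
                                                        ∷ (μ⋆ , replicate 2 (F ∸ 1) ++ (replicate k F ++ (suc F ∷ []))) ∷ []))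
                  fOf≡f mult⋆≡)
           (cong (λ μ′ → full-copies N v f′ ++ ((μ′ , Lshape N v f′) ∷ (+ mult⋆ , L⋆) ∷ [])) mult′≡))

  divisible-admissible : Admissible N v (𝓛 N v)
  divisible-admissible = subst (Admissible N v) (sym 𝓛≡)
    ( ++⁺ (map⁺ (applyUpTo⁺₂ (λ i → i) f′ (λ i → length-Lshape i))) (length-Lshape f′ ∷ length-L⋆ ∷ [])
    , ++⁺ (map⁺ (applyUpTo⁺₂ (λ i → i) f′ (λ _ → ℤ.+≤+ z≤n))) (ℤ.+≤+ z≤n ∷ ℤ.+≤+ z≤n ∷ [])
    , λ x _ → subst (ℤ._≤ + (N C x)) (sym (total-two-more N v f′ mult′ (Lshape N v f′) mult⋆ L⋆ x))
                    (ℤ.+≤+ (divisible-count-≤ g k x)) )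

admissible-when-v∤1+N : ∀ {N} k f′ r → r < suc (suc k) → suc N ≡ suc r ℕ.+ suc f′ ℕ.* (3 ℕ.+ k) →
                           Admissible N (3 ℕ.+ k) (𝓛 N (3 ℕ.+ k))
admissible-when-v∤1+N k f′ r r<2+k 1+N≡ =
  subst (λ n → Admissible n (3 ℕ.+ k) (𝓛 n (3 ℕ.+ k))) (sym (ℕ.suc-injective 1+N≡))
    (subst (λ m′ → let n = r ℕ.+ suc f′ ℕ.* suc (suc m′) in Admissible n (suc (suc m′)) (𝓛 n (suc (suc m′))))
           r+D≡ (nondivisible-admissible f′ r (suc k ∸ r) (subst (1 ≤_) (sym r+D≡) (s≤s z≤n))))
  where
  r+D≡ : r ℕ.+ (suc k ∸ r) ≡ suc k
  r+D≡ = ℕ.m+[n∸m]≡n (ℕ.≤-pred r<2+k)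

admissible-when-v∣1+N : ∀ {N} k g → suc N ≡ suc (suc g) ℕ.* (3 ℕ.+ k) → Admissible N (3 ℕ.+ k) (𝓛 N (3 ℕ.+ k))
admissible-when-v∣1+N k g 1+N≡ =
  subst (λ n → Admissible n (3 ℕ.+ k) (𝓛 n (3 ℕ.+ k))) (ℕ.suc-injective (trans (regroup g k) (sym 1+N≡)))
        (divisible-admissible g k)
  where
  regroup : ∀ g k → suc (suc g ℕ.+ suc (suc g) ℕ.* suc (suc k)) ≡ suc (suc g) ℕ.* suc (suc (suc k))
  regroup = solve-∀

lemma5p2 : (N v : ℕ) → 3 ≤ v → v < N →
    All (λ p → length (proj₂ p) ≡ v) (𝓛 N v)
    × All (λ p → 0ℤ ℤ.≤ proj₁ p) (𝓛 N v)
    × ((x : ℕ) → x ≤ N → total (𝓛 N v) x ℤ.≤ + (N C x))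
lemma5p2 N v@(suc (suc (suc k))) (s≤s (s≤s (s≤s z≤n))) v<N =
  by-division (suc N % v) (suc N / v) (m≡m%n+[m/n]*n (suc N) v) (m%n<n (suc N) v)
  where
  by-division : ∀ ρ q → suc N ≡ ρ ℕ.+ q ℕ.* v → ρ < v → Admissible N v (𝓛 N v)
  by-division zero    (suc (suc g)) 1+N≡ _   = admissible-when-v∣1+N k g 1+N≡
  by-division (suc r) (suc f′)      1+N≡ ρ<v = admissible-when-v∤1+N k f′ r (ℕ.≤-pred ρ<v) 1+N≡
  by-division ρ       zero          1+N≡ ρ<v =
    ⊥-elim (ℕ.<-asym v<N (ℕ.<-trans (ℕ.n<1+n N) (subst (_< v) (sym (trans 1+N≡ (ℕ.+-identityʳ ρ))) ρ<v)))
  by-division zero    (suc zero)    1+N≡ _   =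
    ⊥-elim (ℕ.<-irrefl (sym (trans 1+N≡ (ℕ.+-identityʳ v))) (ℕ.<-trans v<N (ℕ.n<1+n N)))
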